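{- Let $G$ be a connected chordal graph, $\mathcal C$ its set of maximal cliques and $\mathcal S$ its set of minimal vertex separators. The clique tree of $G$ is unique if and only if both of the following hold: (i) $|\mathcal S|=|\mathcal C|-1$, i.e. $\nu(S)=1$ for all $S\in\mathcal S$; (ii) no two distinct minimal vertex separators of $G$ are in an inclusion relation (there are no $S,S'\in\mathcal S$ with $S\subset S'$ properly).
   Context: Graphs are finite, simple and undirected. Maximal cliques are regarded as subsets of the vertex set $V$; $\mathcal C=\{C_1,\dots,C_K\}$. A minimal vertex separator of $G$ is a set $S\subset V$ such that, for some pair of non-adjacent vertices $a,b$, $S$ separates $a$ from $b$ in $G$ and no proper subset of $S$ does. A clique tree of $G$ is a tree $T=(\mathcal C,\mathcal E)$ with node set $\mathcal C$ such that for all $C_1,C_2\in\mathcal C$ and every $C_3\in\mathcal C$ on the unique path in $T$ between $C_1$ and $C_2$, $C_1\cap C_2\subseteq C_3$. For a permutation $\pi$ of $\{1,\dots,K\}$ put $S_{\pi(k)}=(C_{\pi(1)}\cup\cdots\cup C_{\pi(k-1)})\cap C_{\pi(k)}$ for $k=2,\dots,K$. The sequence $C_{\pi(1)},\dots,C_{\pi(K)}$ is a perfect sequence if for all $k\ge2$ the set $S_{\pi(k)}$ is a clique and there exists $k'<k$ with $S_{\pi(k)}\subset C_{\pi(k')}$. It is known that for a perfect sequence $\{S_{\pi(2)},\dots,S_{\pi(K)}\}=\mathcal S$ (with possible repetitions on the left); the multiplicity of $S\in\mathcal S$ is $\nu(S)=\#\{k\in\{2,\dots,K\}\mid S_{\pi(k)}=S\}$,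 which is known not to depend on the perfect sequence $\pi$. -}

module Defs where

open import Level using (0ℓ)
open import Data.Bool.Base using (true; false)
import Data.Bool.Properties as Bool
open import Data.Nat.Base as ℕ using (ℕ; zero; suc)
import Data.Nat.Properties as ℕ
open import Data.Fin.Base using (Fin; toℕ; _<_)
open import Data.Fin.Properties using (_≟_; _<?_; all?; any?)
open import Data.Fin.Permutation using (Permutation′; _⟨$⟩ʳ_)
open import Data.Fin.Subset using
  (Subset; inside; outside; _∈_; _∉_; _⊆_; _⊂_; _⊄_; _∩_; _∪_; ⋃; ⁅_⁆)
open import Data.Fin.Subset.Properties using
  (_∈?_; _⊂?_; anySubset?; x∈⁅x⁆; x∈⁅y⁆⇒x≡y; p⊆p∪q; q⊆p∪q; x∈p∪q⁻)
open import Data.Fin.Subset.Induction using (Acc; acc; ⊃-wellFounded)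
open import Data.Vec.Base using ([]; _∷_)
import Data.Vec.Properties as Vec
open import Data.List.Base as List using
  (List; []; _∷_; _++_; map; filter; length; lookup; allFin)
open import Data.List.Relation.Unary.Any using (Any; here; there)
open import Data.List.Relation.Unary.All using (All; []; _∷_)
open import Data.List.Relation.Unary.All.Properties using (All¬⇒¬Any)
open import Data.List.Relation.Unary.AllPairs using ([]; _∷_)
open import Data.List.Relation.Unary.Unique.Propositional using (Unique)
import Data.List.Relation.Unary.Unique.Propositional.Properties as Unique
import Data.List.Membership.Propositional as List
open import Data.List.Membership.Propositional.Properties using
  (∈-map⁺; ∈-map⁻; ∈-++⁺ˡ; ∈-++⁺ʳ; ∈-filter⁺; ∈-filter⁻)
open import Data.Product.Base using (Σ-syntax; ∃; ∃₂; _×_; _,_; proj₁; proj₂)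
open import Data.Product using (∃!)
open import Data.Sum.Base using (_⊎_; inj₁; inj₂)
open import Function.Base using (_∘_)
open import Function.Bundles using (_⇔_; mk⇔)
open import Function.Definitions using (Injective)
open import Relation.Nullary.Negation using (¬_; contradiction)
open import Relation.Nullary.Decidable using
  (Dec; yes; no; ¬?; map′; _×-dec_; _→-dec_; decidable-stable)
open import Relation.Unary as U using (Pred)
open import Relation.Binary.Core using (Rel)
open import Relation.Binary.Definitions using
  (Decidable; DecidableEquality; Symmetric; Irreflexive)
open import Relation.Binary.Construct.Closure.ReflexiveTransitive using
  (Star; ε; _◅_)
open import Relation.Binary.PropositionalEquality using
  (_≡_; _≢_; refl; sym; subst)

private
  variable
    n : ℕ

------------------------------------------------------------------------
-- Enumerating decidable families of subsets

record Enumeration (P : Pred (Subset n) 0ℓ) : Set where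
  field
    elements : List (Subset n)
    unique   : Unique elements
    correct  : ∀ S → S List.∈ elements ⇔ P S

  size : ℕ
  size = length elements

open Enumeration public

_≟ˢ_ : DecidableEquality (Subset n)
_≟ˢ_ = Vec.≡-dec Bool._≟_

allSubsets : ∀ n → List (Subset n)
allSubsets zero    = [] ∷ []
allSubsets (suc n) = map (inside ∷_) (allSubsets n) ++ map (outside ∷_) (allSubsets n)

∈-allSubsets : (S : Subset n) → S List.∈ allSubsets n
∈-allSubsets []          = here refl
∈-allSubsets (true  ∷ S) = ∈-++⁺ˡ (∈-map⁺ (inside ∷_) (∈-allSubsets S))
∈-allSubsets (false ∷ S) = ∈-++⁺ʳ _ (∈-map⁺ (outside ∷_) (∈-allSubsets S))

allSubsets-unique : ∀ n → Unique (allSubsets n)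
allSubsets-unique zero    = [] ∷ []
allSubsets-unique (suc n) = Unique.++⁺
  (Unique.map⁺ Vec.∷-injectiveʳ (allSubsets-unique n))
  (Unique.map⁺ Vec.∷-injectiveʳ (allSubsets-unique n))
  disjoint
  where
  disjoint : ∀ {S} → ¬ (S List.∈ map (inside ∷_) (allSubsets n)
                       × S List.∈ map (outside ∷_) (allSubsets n))
  disjoint (p , q) with ∈-map⁻ (inside ∷_) p | ∈-map⁻ (outside ∷_) q
  ... | _ , _ , refl | _ , _ , ()

enumerate : {P : Pred (Subset n) 0ℓ} → U.Decidable P → Enumeration P
enumerate {n} P? = record
  { elements = filter P? (allSubsets n)
  ; unique   = Unique.filter⁺ P? (allSubsets-unique n)
  ; correct  = λ S → mk⇔ (proj₂ ∘ ∈-filter⁻ P? {xs = allSubsets n})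
                         (∈-filter⁺ P? (∈-allSubsets S))
  }

------------------------------------------------------------------------
-- Finite simple undirected graphs

record Graph (n : ℕ) : Set₁ where
  infix 4 _~_ _~?_
  field
    _~_      : Rel (Fin n) 0ℓ
    _~?_     : Decidable _~_
    ~-sym    : Symmetric _~_
    ~-irrefl : Irreflexive _≡_ _~_

-- Same edge set.
infix 4 _≋_
_≋_ : Graph n → Graph n → Set
T ≋ T′ = ∀ i j → Graph._~_ T i j ⇔ Graph._~_ T′ i j

module _ (G : Graph n) where
  open Graph G

  Walk : Rel (Fin n) 0ℓ
  Walk = Star _~_

  vertices : ∀ {u v} → Walk u v → List (Fin n)
  vertices {u} ε       = u ∷ []
  vertices {u} (_ ◅ w) = u ∷ vertices w

  IsPath : ∀ {u v} → Walk u v → Set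
  IsPath w = Unique (vertices w)

  Connected : Set
  Connected = ∀ u v → Walk u v

-- The successor relation of the cyclic order on {0, …, m - 1}.
CyclicSuc : ∀ {m} → Rel (Fin m) 0ℓ
CyclicSuc {m} i j = toℕ j ≡ suc (toℕ i) ⊎ (suc (toℕ i) ≡ m × toℕ j ≡ 0)

module _ (G : Graph n) where
  open Graph G

  record Cycle (m : ℕ) : Set where
    field
      3≤m      : 3 ℕ.≤ m
      vertex   : Fin m → Fin n
      distinct : Injective _≡_ _≡_ vertex
      adjacent : ∀ {i j} → CyclicSuc i j → vertex i ~ vertex j

  HasChord : ∀ {m} → Cycle m → Set
  HasChord c = ∃₂ λ i j → Cycle.vertex c i ~ Cycle.vertex c j
                        × ¬ CyclicSuc i j × ¬ CyclicSuc j i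

  Chordal : Set
  Chordal = ∀ {m} → 4 ℕ.≤ m → (c : Cycle m) → HasChord c

  IsTree : Set
  IsTree = Connected G × (∀ {m} → ¬ Cycle m)

------------------------------------------------------------------------
-- Maximal cliques

module _ (G : Graph n) where
  open Graph G

  IsClique : Pred (Subset n) 0ℓ
  IsClique S = ∀ u v → u ∈ S → v ∈ S → u ≢ v → u ~ v

  IsMaximalClique : Pred (Subset n) 0ℓ
  IsMaximalClique S = IsClique S × (∀ R → IsClique R → S ⊄ R)

  isClique? : U.Decidable IsClique
  isClique? S = all? λ u → all? λ v →
    (u ∈? S) →-dec ((v ∈? S) →-dec ((¬? (u ≟ v)) →-dec (u ~? v)))

  isMaximalClique? : U.Decidable IsMaximalClique
  isMaximalClique? S = isClique? S ×-dec
    map′ (λ ¬∃ R clique S⊂R → ¬∃ (R , clique , S⊂R))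
         (λ max (R , clique , S⊂R) → max R clique S⊂R)
         (¬? (anySubset? λ R → isClique? R ×-dec (S ⊂? R)))

  maximalCliques : Enumeration IsMaximalClique
  maximalCliques = enumerate isMaximalClique?

  ∣𝒞∣ : ℕ
  ∣𝒞∣ = size maximalCliques

  -- The fixed labelling C₀, …, C_{∣𝒞∣-1} of the maximal cliques.
  C : Fin ∣𝒞∣ → Subset n
  C = lookup (elements maximalCliques)

------------------------------------------------------------------------
-- Minimal vertex separators

  -- a and b are vertices outside S, in different components of G ∖ S.
  Separates : Subset n → Rel (Fin n) 0ℓ
  Separates S a b = a ∉ S × b ∉ S × ((w : Walk G a b) → Any (_∈ S) (vertices G w))

  IsMinimalSeparator : Pred (Subset n) 0ℓ
  IsMinimalSeparator S = ∃₂ λ a b → a ≢ b × ¬ (a ~ b)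
    × Separates S a b × (∀ R → R ⊂ S → ¬ Separates R a b)

  Avoiding : Subset n → Rel (Fin n) 0ℓ
  Avoiding S x b = Σ[ w ∈ Walk G x b ] All (_∉ S) (vertices G w)

  -- The component of b in G ∖ S.
  record Component (S : Subset n) (b : Fin n) : Set where
    field
      D      : Subset n
      b∈D    : b ∈ D
      sound  : ∀ {x} → x ∈ D → Avoiding S x b
      closed : ∀ {x y} → x ∈ D → x ~ y → y ∉ S → y ∈ D

  module _ (S : Subset n) (b : Fin n) where
    grow : (D : Subset n) → Acc (λ p q → q ⊂ p) D → b ∈ D →
           (∀ {x} → x ∈ D → Avoiding S x b) → Component S b
    grow D (acc rec) b∈D sound
      with any? (λ x → any? (λ y →
             (x ∈? D) ×-dec ((x ~? y) ×-dec (¬? (y ∈? S) ×-dec ¬? (y ∈? D)))))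
    ... | no ¬∃ = record
      { D = D ; b∈D = b∈D ; sound = sound
      ; closed = λ {x} {y} x∈D x~y y∉S → decidable-stable (y ∈? D)
          λ y∉D → ¬∃ (x , y , x∈D , x~y , y∉S , y∉D)
      }
    ... | yes (x , y , x∈D , x~y , y∉S , y∉D) =
      grow (D ∪ ⁅ y ⁆)
           (rec (p⊆p∪q ⁅ y ⁆ , y , q⊆p∪q D ⁅ y ⁆ (x∈⁅x⁆ y) , y∉D))
           (p⊆p∪q ⁅ y ⁆ b∈D) sound′
      where
      sound′ : ∀ {z} → z ∈ D ∪ ⁅ y ⁆ → Avoiding S z b
      sound′ z∈ with x∈p∪q⁻ D ⁅ y ⁆ z∈
      ... | inj₁ z∈D = sound z∈D
      ... | inj₂ z∈y with refl ← x∈⁅y⁆⇒x≡y y z∈y =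
        let w , avoids = sound x∈D in ~-sym x~y ◅ w , y∉S ∷ avoids

    component : b ∉ S → Component S b
    component b∉S = grow ⁅ b ⁆ (⊃-wellFounded _) (x∈⁅x⁆ b) λ x∈b →
      subst (λ x → Avoiding S x b) (sym (x∈⁅y⁆⇒x≡y b x∈b)) (ε , b∉S ∷ [])

  meets : ∀ {S b} (K : Component S b) {x} → x ∉ Component.D K →
          (w : Walk G x b) → Any (_∈ S) (vertices G w)
  meets K x∉D ε = contradiction (Component.b∈D K) x∉D
  meets {S} K {x} x∉D (_◅_ {j = y} x~y w) with y ∈? Component.D K | x ∈? S
  ... | _       | yes x∈S = here x∈S
  ... | no y∉D  | no _    = there (meets K y∉D w)
  ... | yes y∈D | no x∉S  =
    contradiction (Component.closed K y∈D (~-sym x~y) x∉S) x∉D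

  separates? : ∀ S a b → Dec (Separates S a b)
  separates? S a b with a ∈? S | b ∈? S
  ... | yes a∈S | _       = no λ (a∉S , _) → a∉S a∈S
  ... | no _    | yes b∈S = no λ (_ , b∉S , _) → b∉S b∈S
  ... | no a∉S  | no b∉S with component S b b∉S
  ...   | K with a ∈? Component.D K
  ...     | no a∉D  = yes (a∉S , b∉S , meets K a∉D)
  ...     | yes a∈D = no λ (_ , _ , sep) →
    let w , avoids = Component.sound K a∈D in All¬⇒¬Any avoids (sep w)

  isMinimalSeparator? : U.Decidable IsMinimalSeparator
  isMinimalSeparator? S = any? λ a → any? λ b →
    ¬? (a ≟ b) ×-dec (¬? (a ~? b) ×-dec (separates? S a b ×-dec
    map′ (λ ¬∃ R R⊂S sep → ¬∃ (R , R⊂S , sep))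
         (λ min (R , R⊂S , sep) → min R R⊂S sep)
         (¬? (anySubset? λ R → (R ⊂? S) ×-dec separates? R a b))))

  minimalSeparators : Enumeration IsMinimalSeparator
  minimalSeparators = enumerate isMinimalSeparator?

  ∣𝒮∣ : ℕ
  ∣𝒮∣ = size minimalSeparators

  NoInclusions : Set
  NoInclusions = ∀ S S′ → IsMinimalSeparator S → IsMinimalSeparator S′ → S ⊄ S′

------------------------------------------------------------------------
-- Clique trees: the node i of T stands for the maximal clique C i

  IsCliqueTree : Graph ∣𝒞∣ → Set
  IsCliqueTree T = IsTree T ×
    (∀ {i j} (p : Walk T i j) → IsPath T p →
     ∀ {k} → k List.∈ vertices T p → C i ∩ C j ⊆ C k)

  UniqueCliqueTree : Set₁
  UniqueCliqueTree = ∃! _≋_ IsCliqueTree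

------------------------------------------------------------------------
-- Perfect sequences, with positions counted from 0

  module _ (π : Permutation′ ∣𝒞∣) where

    separatorAt : Fin ∣𝒞∣ → Subset n
    separatorAt k =
      ⋃ (map (λ j → C (π ⟨$⟩ʳ j)) (filter (_<? k) (allFin ∣𝒞∣))) ∩ C (π ⟨$⟩ʳ k)

    IsPerfect : Set
    IsPerfect = ∀ k → 0 ℕ.< toℕ k → IsClique (separatorAt k)
      × ∃ λ k′ → k′ < k × separatorAt k ⊆ C (π ⟨$⟩ʳ k′)

    ν : Subset n → ℕ
    ν S = length (filter (λ k → (0 ℕ.<? toℕ k) ×-dec (separatorAt k ≟ˢ S)) (allFin ∣𝒞∣))

{-# OPTIONS --safe #-}
module Submission where

open import Defs
open import Data.Nat.Base using (ℕ; _∸_)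
open import Data.Product.Base using (_×_)
open import Data.Fin.Permutation using (Permutation′)
open import Function.Bundles using (_⇔_)
open import Relation.Binary.PropositionalEquality using (_≡_)
open import Data.Fin.Base using (Fin; _<_; fromℕ; fromℕ<; inject₁; suc; toℕ; zero)
open import Data.Fin.Permutation using (_⟨$⟩ʳ_; _⟨$⟩ˡ_; inverseʳ; inverseˡ)
open import Data.Fin.Properties using
  (_<?_; _≟_; any?; injective⇒≤; suc-injective; toℕ-fromℕ; toℕ-fromℕ<; toℕ-injective;
   toℕ-inject₁; toℕ<n)
open import Data.Fin.Subset using
  (Subset; _-_; _∈_; _∉_; _∩_; _∪_; _⊂_; _⊄_; _⊆_; ⁅_⁆; ∁; ⊤; ⊥; ⋃)
open import Data.Fin.Subset.Induction using (⊂-wellFounded; ⊃-wellFounded)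
open import Data.Fin.Subset.Properties using
  (_∈?_; _⊂?_; _⊆?_; anySubset?; p∩q⊆p; p∩q⊆q; p⊂q⇒p⊆q; p⊆p∪q; p─q⊆p; x∈p⇒p-x⊂p;
   x∈p∧x≢y⇒x∈p-y; x∈p∩q⁺; x∈p∩q⁻; x∈p∪q⁺; x∈p∪q⁻; x∈⁅x⁆; x∈⁅y⁆⇒x≡y; x∈∁p⇒x∉p; x∉∁p⇒x∈p;
   ∈⊤; ∉⊥; ⊆-antisym)
open import Data.List.Base using (List; []; _∷_; allFin; filter; length; lookup; map)
import Data.List.Membership.Propositional as List
open import Data.List.Membership.Propositional.Properties using
  (∈-allFin; ∈-filter⁺; ∈-filter⁻; ∈-lookup; ∈-map⁺; ∈-map⁻)
open import Data.List.Relation.Unary.All as All using (All; []; _∷_)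
open import Data.List.Relation.Unary.All.Properties using (All¬⇒¬Any)
open import Data.List.Relation.Unary.AllPairs using ([]; _∷_)
open import Data.List.Relation.Unary.Any as Any using (Any; here; there)
open import Data.List.Relation.Unary.Any.Properties using (lookup-index)
open import Data.List.Relation.Unary.Unique.Propositional using (Unique)
open import Data.Nat.Base as ℕ using (_+_; suc; s≤s; zero; z≤n)
open import Data.Nat.Induction using (<-wellFounded)
open import Data.Product using (∃!)
open import Data.Product.Base using (_,_; proj₁; proj₂; Σ-syntax; ∃; ∃₂)
open import Data.Sum.Base as Sum using (_⊎_; inj₁; inj₂)
open import Data.Vec.Base using (tabulate)
open import Data.Vec.Properties using ([]=⇒lookup; lookup⇒[]=; lookup∘tabulate)
open import Function.Base using (_∘_; id)
open import Function.Bundles using (Equivalence; mk⇔)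
open import Function.Construct.Composition using (_⇔-∘_)
open import Induction.WellFounded using (Acc; acc)
open import Level using (0ℓ)
open import Relation.Binary.Construct.Closure.ReflexiveTransitive using
  (_◅_; _◅◅_; reverse; ε)
open import Relation.Binary.Definitions using (tri<; tri>; tri≈)
open import Relation.Binary.PropositionalEquality using
  (_≢_; cong; refl; subst; subst₂; sym; trans)
open import Relation.Nullary.Decidable using
  (Dec; _×-dec_; _⊎-dec_; dec-true; decidable-stable; does; map′; no; yes; ¬?)
open import Relation.Nullary.Negation using (contradiction; ¬_)
open import Relation.Unary as U using (Pred)
import Data.Nat.Properties as ℕ
import Data.List.Relation.Unary.Unique.Propositional.Properties as Unique

-- Root a clique tree; every edge joins a clique e ≢ root to its parent, and its separator is
-- C e ∩ C (parent e). The separators of the edges are exactly the minimal vertex separators,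
-- and so are those of a perfect sequence, which is a clique tree listed from the root. As there
-- are ∣𝒞∣ - 1 edges, ∣𝒮∣ ≡ ∣𝒞∣ ∸ 1 says that distinct edges have distinct separators.
-- If also no inclusions occur, an edge i – j of one clique tree is an edge of any other one:
-- C i ∩ C j lies in, hence equals, all separators on the path from i to j there, so the path
-- has length one. Conversely, if the separator of one edge lies in that of another, then there
-- are adjacent edges x – y – z with C x ∩ C y ⊆ C z, and replacing x – y by x – z gives a second
-- clique tree. A clique tree exists by adding simplicial vertices one at a time (Dirac).

-- Rooting names each edge by its lower end, so edges are counted by injections between finite sets,
-- and the clique tree condition becomes local: what `C i` shares with any clique outside the
-- subtree of `i` lies in `C (parent i)`. The root may be chosen freely; with `z` as root,
-- exchanging x - y for x - z changes the single value `parent x`. A minimal separator `S` of `a`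
-- and `b` is the separator of an edge for this reason: if no edge with separator inside `S` had `a`
-- and `b` on different sides, one could climb from both through vertices outside `S`, since every
-- other edge offers such a vertex, and the two climbs would end in the same clique. The two
-- conditions of the theorem are used as one: the separators of distinct edges are never nested.
-- Equality violates the count, proper inclusion the second condition, and the exchange of edges
-- treats both alike.

unique⇒lookup-injective : ∀ {A : Set} {xs : List A} → Unique xs →
  ∀ {i j} → lookup xs i ≡ lookup xs j → i ≡ j
unique⇒lookup-injective (_ ∷ _)   {zero}  {zero}  _  = refl
unique⇒lookup-injective (x∉ ∷ _)  {zero}  {suc j} eq =
  contradiction eq (All.lookup x∉ (∈-lookup j))
unique⇒lookup-injective (x∉ ∷ _)  {suc i} {zero}  eq =
  contradiction (sym eq) (All.lookup x∉ (∈-lookup i))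
unique⇒lookup-injective (_ ∷ xs!) {suc i} {suc j} eq =
  cong suc (unique⇒lookup-injective xs! eq)

-- Walks, chordless paths and cycles

module _ {n} (G : Graph n) where
  open Graph G

  Within : Pred (Fin n) 0ℓ → Fin n → Fin n → Set
  Within P u v = Σ[ w ∈ Walk G u v ] All P (vertices G w)

  module _ {P : Pred (Fin n) 0ℓ} where

    start : ∀ {u v} (w : Walk G u v) → All P (vertices G w) → P u
    start ε       (pu ∷ _) = pu
    start (_ ◅ _) (pu ∷ _) = pu

    within-trans : ∀ {u v x} → Within P u v → Within P v x → Within P u x
    within-trans (ε     , _)       q = q
    within-trans (e ◅ p , pu ∷ ps) q =
      let r , rs = within-trans (p , ps) q in e ◅ r , pu ∷ rs

    within-edge : ∀ {u v} → u ~ v → P u → P v → Within P u v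
    within-edge e pu pv = e ◅ ε , pu ∷ pv ∷ []

    within-sym : ∀ {u v} → Within P u v → Within P v u
    within-sym (ε     , ps)      = ε , ps
    within-sym (e ◅ p , pu ∷ ps) =
      within-trans (within-sym (p , ps)) (within-edge (~-sym e) (start p ps) pu)

  within-map : ∀ {P Q : Pred (Fin n) 0ℓ} → (∀ {x} → P x → Q x) →
    ∀ {u v} → Within P u v → Within Q u v
  within-map f (w , ps) = w , All.map f ps

  start∈ : ∀ {u v} (w : Walk G u v) → u List.∈ vertices G w
  start∈ ε       = here refl
  start∈ (_ ◅ _) = here refl

  end∈ : ∀ {u v} (w : Walk G u v) → v List.∈ vertices G w
  end∈ ε       = here refl
  end∈ (_ ◅ w) = there (end∈ w)

  -- The vertex lists of chordless paths ending in t.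
  data Chordless (t : Fin n) : List (Fin n) → Set where
    end  : Chordless t (t ∷ [])
    step : ∀ {u v l} → u ~ v → All (λ z → u ≢ z × ¬ u ~ z) l →
           Chordless t (v ∷ l) → Chordless t (u ∷ v ∷ l)

  -- The path is cut at the last vertex that equals `u` or is adjacent to it, so joining `u` there
  -- creates no chord.
  extend : ∀ {t l} u → Chordless t l → Any (λ z → u ≡ z ⊎ u ~ z) l →
    ∃ λ l′ → Chordless t (u ∷ l′) × (∀ {z} → z List.∈ u ∷ l′ → z List.∈ u ∷ l)
  extend u end (here (inj₁ refl)) = _ , end , there
  extend u end (here (inj₂ u~t))  = _ , step u~t [] end , id
  extend u (step {v} {x} {l} e far c) hit
    with Any.any? (λ z → (u ≟ z) ⊎-dec (u ~? z)) (x ∷ l)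
  ... | yes later =
    let l′ , c′ , sub = extend u c later
    in l′ , c′ , λ z∈ → skip (sub z∈)
    where
    skip : ∀ {z} → z List.∈ u ∷ x ∷ l → z List.∈ u ∷ v ∷ x ∷ l
    skip (here z≡) = here z≡
    skip (there z∈) = there (there z∈)
  ... | no ¬later with hit
  ...   | there later = contradiction later ¬later
  ...   | here (inj₁ refl) = _ , step e far c , there
  ...   | here (inj₂ u~v)  = _ , step u~v (All.tabulate λ z∈ →
            (λ u≡z → ¬later (Any.map (λ { refl → inj₁ u≡z }) z∈)) ,
            (λ u~z → ¬later (Any.map (λ { refl → inj₂ u~z }) z∈))) (step e far c) , id

  chordless : ∀ {s t} (w : Walk G s t) →
    ∃ λ l → Chordless t (s ∷ l) × (∀ {z} → z List.∈ s ∷ l → z List.∈ vertices G w)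
  chordless ε = [] , end , id
  chordless {s} (e ◅ w) =
    let l , c , sub = chordless w
        l′ , c′ , sub′ = extend s c (here (inj₂ e))
    in l′ , c′ , λ z∈ → weaken sub (sub′ z∈)
    where
    weaken : ∀ {A : Set} {x : A} {l l′} → (∀ {z} → z List.∈ l → z List.∈ l′) →
             ∀ {z} → z List.∈ x ∷ l → z List.∈ x ∷ l′
    weaken sub (here z≡)  = here z≡
    weaken sub (there z∈) = there (sub z∈)

  module _ {t : Fin n} where

    target∈ : ∀ {l} → Chordless t l → t List.∈ l
    target∈ end          = here refl
    target∈ (step _ _ c) = there (target∈ c)

    chordless-fresh : ∀ {u v l} → u ~ v → All (λ z → u ≢ z × ¬ u ~ z) l → All (u ≢_) (v ∷ l)
    chordless-fresh u~v far = (λ u≡v → ~-irrefl u≡v u~v) ∷ All.map proj₁ far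

    chordless-unique : ∀ {l} → Chordless t l → Unique l
    chordless-unique end            = [] ∷ []
    chordless-unique (step e far c) = chordless-fresh e far ∷ chordless-unique c

    chordless-suc : ∀ {l} → Chordless t l → ∀ {i j} → toℕ j ≡ suc (toℕ i) →
      lookup l i ~ lookup l j
    chordless-suc end {zero} {zero} ()
    chordless-suc (step e _ _) {zero}  {suc zero} _  = e
    chordless-suc (step _ _ c) {suc i} {suc j}    eq = chordless-suc c (ℕ.suc-injective eq)

    chordless-last : ∀ {l} → Chordless t l → ∀ {i} → suc (toℕ i) ≡ length l → lookup l i ≡ t
    chordless-last end          {zero}  _  = refl
    chordless-last (step _ _ c) {suc i} eq = chordless-last c (ℕ.suc-injective eq)

    chordless-last⁻ : ∀ {l} → Chordless t l → ∀ {i} → lookup l i ≡ t → suc (toℕ i) ≡ length l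
    chordless-last⁻ end            {zero}  _    = refl
    chordless-last⁻ (step e far c) {zero}  refl =
      contradiction refl (All.lookup (chordless-fresh e far) (target∈ c))
    chordless-last⁻ (step _ _ c)   {suc i} eq   = cong suc (chordless-last⁻ c eq)

    chordless-chord : ∀ {l} → Chordless t l → ∀ {i j} → lookup l i ~ lookup l j →
      toℕ j ≡ suc (toℕ i) ⊎ toℕ i ≡ suc (toℕ j)
    chordless-chord end {zero} {zero} t~t = contradiction t~t (~-irrefl refl)
    chordless-chord (step _ _ _) {zero} {zero} u~u = contradiction u~u (~-irrefl refl)
    chordless-chord (step _ _ _) {zero} {suc zero} _ = inj₁ refl
    chordless-chord (step _ far _) {zero} {suc (suc j)} u~z =
      contradiction u~z (proj₂ (All.lookup far (∈-lookup j)))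
    chordless-chord (step _ _ _) {suc zero} {zero} _ = inj₂ refl
    chordless-chord (step _ far _) {suc (suc i)} {zero} z~u =
      contradiction (~-sym z~u) (proj₂ (All.lookup far (∈-lookup i)))
    chordless-chord (step _ _ c) {suc i} {suc j} adj =
      Sum.map (cong suc) (cong suc) (chordless-chord c adj)

  closeUp : ∀ {x s t l} → Chordless t (s ∷ l) → s ≢ t → All (x ≢_) (s ∷ l) →
    x ~ s → t ~ x → Cycle G (suc (length (s ∷ l)))
  closeUp {l = []} end s≢t = contradiction refl s≢t
  closeUp {x} {s} {t} {l = l@(_ ∷ _)} c s≢t fresh x~s t~x = record
    { 3≤m      = s≤s (s≤s (s≤s z≤n))
    ; vertex   = lookup (x ∷ s ∷ l)
    ; distinct = unique⇒lookup-injective (fresh ∷ chordless-unique c)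
    ; adjacent = adj
    }
    where
    adj : ∀ {i j} → CyclicSuc i j → lookup (x ∷ s ∷ l) i ~ lookup (x ∷ s ∷ l) j
    adj {zero}  {suc zero} (inj₁ _)  = x~s
    adj {suc i} {suc j}    (inj₁ eq) = chordless-suc c (ℕ.suc-injective eq)
    adj {suc i} {zero}     (inj₂ (eq , _)) =
      subst (_~ x) (sym (chordless-last c (ℕ.suc-injective eq))) t~x

  Acyclic : Set
  Acyclic = ∀ {m} → ¬ Cycle G m

  -- A chordless path inside the walk has distinct vertices and avoids `x`, so `x` closes it up to a
  -- cycle.
  no-detour : Acyclic → ∀ {x s t} → x ~ s → x ~ t → s ≢ t → ¬ Within (x ≢_) s t
  no-detour acyclic x~s x~t s≢t (w , avoids) =
    let l , c , sub = chordless w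
    in acyclic (closeUp c s≢t (All.tabulate (All.lookup avoids ∘ sub)) x~s (~-sym x~t))

  -- Otherwise a chordless path from s to t inside the walk, closed up by x, is a chordless
  -- cycle of length at least four.
  neighbours-adjacent : Chordal G → ∀ {x s t} → x ~ s → x ~ t → s ≢ t →
    (w : Walk G s t) → All (λ z → z ≡ s ⊎ z ≡ t ⊎ (x ≢ z × ¬ x ~ z)) (vertices G w) → s ~ t
  neighbours-adjacent chordal {x} {s} {t} x~s x~t s≢t w inner
    with s ~? t
  ... | yes s~t = s~t
  ... | no ¬s~t with chordless w
  ...   | [] , end , _ = contradiction refl s≢t
  ...   | _ ∷ [] , step s~t _ end , _ = contradiction s~t ¬s~t
  ...   | l@(_ ∷ _ ∷ _) , c , sub =
    let i , j , adj , ¬ij , ¬ji = chordal (s≤s (s≤s (s≤s (s≤s z≤n)))) cyc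
    in contradiction adj (chord ¬ij ¬ji)
    where
    inner′ : ∀ i → lookup (s ∷ l) i ≡ s ⊎ lookup (s ∷ l) i ≡ t ⊎ _
    inner′ i = All.lookup inner (sub (∈-lookup i))
    x≢ : ∀ {y z} → x ~ y → z ≡ y → x ≢ z
    x≢ x~y refl x≡y = ~-irrefl x≡y x~y
    fresh : All (x ≢_) (s ∷ l)
    fresh = All.tabulate λ z∈ →
      Sum.[ x≢ x~s , Sum.[ x≢ x~t , proj₁ ] ] (All.lookup inner (sub z∈))
    cyc = closeUp c s≢t fresh x~s (~-sym x~t)
    -- On the walk only `s` and `t` can be adjacent to `x`; they are the two ends of the path, so an
    -- edge at `x` joins cyclic neighbours.
    spoke : ∀ {j} → x ~ lookup (s ∷ l) j → toℕ j ≡ 0 ⊎ suc (toℕ j) ≡ length (s ∷ l)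
    spoke {j} adj with inner′ j
    ... | inj₁ eq = inj₁ (cong toℕ
      (unique⇒lookup-injective (chordless-unique c) {j} {zero} eq))
    ... | inj₂ (inj₁ eq) = inj₂ (chordless-last⁻ c eq)
    ... | inj₂ (inj₂ (_ , ¬adj)) = contradiction adj ¬adj
    chord : ∀ {i j} → ¬ CyclicSuc i j → ¬ CyclicSuc j i →
            ¬ lookup (x ∷ s ∷ l) i ~ lookup (x ∷ s ∷ l) j
    chord {zero}  {zero}  _   _   adj = ~-irrefl refl adj
    chord {zero}  {suc j} ¬ij ¬ji adj = Sum.[ (λ eq → ¬ij (inj₁ (cong suc eq))) ,
      (λ eq → ¬ji (inj₂ (cong suc eq , refl))) ] (spoke adj)
    chord {suc i} {zero}  ¬ij ¬ji adj = Sum.[ (λ eq → ¬ji (inj₁ (cong suc eq))) ,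
      (λ eq → ¬ij (inj₂ (cong suc eq , refl))) ] (spoke (~-sym adj))
    chord {suc i} {suc j} ¬ij ¬ji adj = Sum.[ (λ eq → ¬ij (inj₁ (cong suc eq))) ,
      (λ eq → ¬ji (inj₁ (cong suc eq))) ] (chordless-chord c adj)

  -- Paths in acyclic graphs

  suffix : ∀ {u v} (p : Walk G u v) → IsPath G p → ∀ {k} → k List.∈ vertices G p →
    Σ[ q ∈ Walk G k v ] IsPath G q × (∀ {z} → z List.∈ vertices G q → z List.∈ vertices G p)
  suffix ε p! (here refl) = ε , p! , id
  suffix (e ◅ p) p! (here refl) = e ◅ p , p! , id
  suffix (e ◅ p) (_ ∷ p!) (there k∈) =
    let q , q! , sub = suffix p p! k∈ in q , q! , there ∘ sub

  toPath : ∀ {u v} (w : Walk G u v) →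
    Σ[ p ∈ Walk G u v ] IsPath G p × (∀ {z} → z List.∈ vertices G p → z List.∈ vertices G w)
  toPath ε = ε , [] ∷ [] , id
  toPath {u} (e ◅ w) with toPath w
  ... | p , p! , sub with Any.any? (u ≟_) (vertices G p)
  ...   | yes u∈ = let q , q! , sub′ = suffix p p! u∈ in q , q! , there ∘ sub ∘ sub′
  ...   | no u∉ = e ◅ p , All.tabulate (λ z∈ u≡z → u∉ (subst (List._∈ _) (sym u≡z) z∈)) ∷ p! ,
    λ { (here z≡) → here z≡ ; (there z∈) → there (sub z∈) }

  -- Where two paths part after `u`, their tails join two neighbours of `u` while avoiding `u`.
  -- Vertex lists are compared instead of walks because an edge may have several proofs.
  path-unique : Acyclic → ∀ {u v} (p q : Walk G u v) → IsPath G p → IsPath G q →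
    vertices G p ≡ vertices G q
  path-unique _ ε ε _ _ = refl
  path-unique _ ε (_ ◅ q) _ (u∉ ∷ _) = contradiction refl (All.lookup u∉ (end∈ q))
  path-unique _ (_ ◅ p) ε (u∉ ∷ _) _ = contradiction refl (All.lookup u∉ (end∈ p))
  path-unique acyclic {u} (_◅_ {j = a} e p) (_◅_ {j = b} f q) (u∉p ∷ p!) (u∉q ∷ q!)
    with a ≟ b
  ... | yes refl = cong (u ∷_) (path-unique acyclic p q p! q!)
  ... | no a≢b = contradiction
    (within-trans (p , u∉p) (within-sym (q , u∉q))) (no-detour acyclic e f a≢b)

  -- To place the path inside a set it is thus enough to find any walk there.
  path⊆walk : Acyclic → ∀ {u v} (p w : Walk G u v) → IsPath G p →
    ∀ {z} → z List.∈ vertices G p → z List.∈ vertices G w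
  path⊆walk acyclic p w p! z∈ =
    let q , q! , sub = toPath w
    in sub (subst (_ List.∈_) (path-unique acyclic p q p! q!) z∈)

-- Rooted trees

argmax : ∀ {m} (f : Fin (suc m) → ℕ) → ∃ λ k → ∀ j → f j ℕ.≤ f k
argmax {zero}  f = zero , λ { zero → ℕ.≤-refl }
argmax {suc m} f with argmax (f ∘ suc)
... | k , max with ℕ.≤-total (f zero) (f (suc k))
...   | inj₁ f0≤fk = suc k , λ { zero → f0≤fk ; (suc j) → max j }
...   | inj₂ fk≤f0 = zero , λ { zero → ℕ.≤-refl ; (suc j) → ℕ.≤-trans (max j) fk≤f0 }

cyclic-neighbours : ∀ {m} → 3 ℕ.≤ m → (k : Fin m) →
  ∃₂ λ i j → CyclicSuc i k × CyclicSuc k j × i ≢ j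
cyclic-neighbours {suc (suc (suc m))} (s≤s (s≤s (s≤s _))) zero =
  fromℕ (2 + m) , suc zero , inj₂ (cong suc (toℕ-fromℕ _) , refl) , inj₁ refl , λ ()
cyclic-neighbours {suc (suc (suc m))} (s≤s (s≤s (s≤s _))) (suc k)
  with ℕ.m≤n⇒m<n∨m≡n (toℕ<n (suc k))
... | inj₁ k+1<m = inject₁ k , fromℕ< k+1<m , inj₁ (cong suc (sym (toℕ-inject₁ k))) ,
  inj₁ (toℕ-fromℕ< k+1<m) , λ i≡j → ℕ.m≢1+n+m (toℕ k) {1}
    (trans (sym (toℕ-inject₁ k)) (trans (cong toℕ i≡j) (toℕ-fromℕ< k+1<m)))
... | inj₂ k+1≡m = inject₁ k , zero , inj₁ (cong suc (sym (toℕ-inject₁ k))) ,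
  inj₂ (k+1≡m , refl) , λ i≡0 → ℕ.1+n≢0 (trans (sym (ℕ.suc-injective (ℕ.suc-injective k+1≡m)))
    (trans (sym (toℕ-inject₁ k)) (cong toℕ i≡0)))

-- The value `parent root` is a mere default. `rank` is any function that drops toward the root, so
-- a position in a list can serve, and an exchange of edges can keep the old ranks.
record RootedTree (K : ℕ) : Set where
  field
    root     : Fin K
    parent   : Fin K → Fin K
    rank     : Fin K → ℕ
    descends : ∀ {i} → i ≢ root → rank (parent i) ℕ.< rank i

  -- The subtree hanging at `i`: one of the two sides into which the edge above `i` cuts the tree.
  data Below (i : Fin K) : Fin K → Set where
    here : Below i i
    up   : ∀ {j} → j ≢ root → Below i (parent j) → Below i j

  below-rank : ∀ {i j} → Below i j → rank i ℕ.≤ rank j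
  below-rank here       = ℕ.≤-refl
  below-rank (up j≢r b) = ℕ.≤-trans (below-rank b) (ℕ.<⇒≤ (descends j≢r))

  below-antisym : ∀ {i j} → Below i j → Below j i → i ≡ j
  below-antisym here       _ = refl
  below-antisym (up j≢r b) c =
    contradiction (ℕ.≤-trans (descends j≢r) (below-rank c)) (ℕ.≤⇒≯ (below-rank b))

  below-step : ∀ {i j} → i ≢ j → Below i j → j ≢ root × Below i (parent j)
  below-step i≢j here       = contradiction refl i≢j
  below-step _   (up j≢r b) = j≢r , b

  ¬below-parent : ∀ {i} → i ≢ root → ¬ Below i (parent i)
  ¬below-parent i≢r b = ℕ.≤⇒≯ (below-rank b) (descends i≢r)

  parent-≢ : ∀ {i} → i ≢ root → i ≢ parent i
  parent-≢ i≢r i≡ = ℕ.<-irrefl (cong rank (sym i≡)) (descends i≢r)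

  private
    below?′ : ∀ i j → Acc ℕ._<_ (rank j) → Dec (Below i j)
    below?′ i j (acc rec) with i ≟ j | j ≟ root
    ... | yes refl | _      = yes here
    ... | no i≢j   | yes j≡r = no λ b → proj₁ (below-step i≢j b) j≡r
    ... | no i≢j   | no j≢r  =
      map′ (up j≢r) (proj₂ ∘ below-step i≢j) (below?′ i (parent j) (rec (descends j≢r)))

    root-below′ : ∀ j → Acc ℕ._<_ (rank j) → Below root j
    root-below′ j (acc rec) with j ≟ root
    ... | yes refl = here
    ... | no j≢r   = up j≢r (root-below′ (parent j) (rec (descends j≢r)))

  below? : ∀ i j → Dec (Below i j)
  below? i j = below?′ i j (<-wellFounded _)

  root-below : ∀ j → Below root j
  root-below j = root-below′ j (<-wellFounded _)

  ¬below⇒≢root : ∀ {i j} → ¬ Below i j → i ≢ root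
  ¬below⇒≢root ¬b refl = ¬b (root-below _)

  incomparable : ∀ {i j} → i ≢ j → ¬ Below i j ⊎ ¬ Below j i
  incomparable {i} {j} i≢j with below? i j
  ... | no ¬b = inj₁ ¬b
  ... | yes b = inj₂ λ c → i≢j (below-antisym b c)

  Edge : Fin K → Fin K → Set
  Edge i j = (i ≢ root × j ≡ parent i) ⊎ (j ≢ root × i ≡ parent j)

  edge? : ∀ i j → Dec (Edge i j)
  edge? i j = (¬? (i ≟ root) ×-dec (j ≟ parent i)) ⊎-dec (¬? (j ≟ root) ×-dec (i ≟ parent j))

  asGraph : Graph K
  asGraph = record
    { _~_      = Edge
    ; _~?_     = edge?
    ; ~-sym    = Sum.swap
    ; ~-irrefl = λ { refl (inj₁ (i≢r , i≡)) → parent-≢ i≢r i≡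
                   ; refl (inj₂ (i≢r , i≡)) → parent-≢ i≢r i≡ }
    }

  private
    toRoot : ∀ i → Acc ℕ._<_ (rank i) → Walk asGraph i root
    toRoot i (acc rec) with i ≟ root
    ... | yes refl = ε
    ... | no i≢r   = inj₁ (i≢r , refl) ◅ toRoot (parent i) (rec (descends i≢r))

    -- Both cyclic neighbours of a vertex of maximal rank would be its parent.
    acyclic : Acyclic asGraph
    acyclic {suc m} c =
      let open Cycle c
          k , max = argmax (rank ∘ vertex)
          i , j , i→k , k→j , i≢j = cyclic-neighbours 3≤m k
          above : ∀ l → Edge (vertex k) (vertex l) → vertex l ≡ parent (vertex k)
          above = λ { l (inj₁ (_ , eq)) → eq
                    ; l (inj₂ (l≢r , eq)) → contradiction (max l)
                        (ℕ.<⇒≱ (subst (λ z → rank z ℕ.< rank (vertex l)) (sym eq) (descends l≢r))) }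
      in i≢j (distinct (trans (above i (Sum.swap (adjacent i→k)))
                              (sym (above j (adjacent k→j)))))

  isTree : IsTree asGraph
  isTree = (λ i j → toRoot i (<-wellFounded _) ◅◅
                    reverse Sum.swap (toRoot j (<-wellFounded _)))
         , acyclic

-- Junction trees: the running intersection property in rooted form

record JunctionTree {K n} (C : Fin K → Subset n) : Set where
  field
    tree : RootedTree K
  open RootedTree tree public
  field
    running : ∀ {i j} → ¬ Below i j → ∀ {x} → x ∈ C i → x ∈ C j → x ∈ C (parent i)

  separator : Fin K → Subset n
  separator i = C i ∩ C (parent i)

  -- On the climb from `i` to `e` each subtree lies in that of `e` and so misses `j`; hence
  -- `running` hands `x` on to every parent, up to that of `e`.
  leave : ∀ {e i j} → Below e i → ¬ Below e j → ∀ {x} → x ∈ C i → x ∈ C j → x ∈ separator e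
  leave here          ¬b xi xj = x∈p∩q⁺ (xi , running ¬b xi xj)
  leave {e} {i} {j} (up i≢r b) ¬b xi xj with below? i j
  ... | no ¬b′ = leave b ¬b (running ¬b′ xi xj) xj
  ... | yes b′ = contradiction (below-trans b b′) ¬b
    where
    below-trans : ∀ {j} → Below e (parent i) → Below i j → Below e j
    below-trans b here       = up i≢r b
    below-trans b (up j≢r c) = up j≢r (below-trans b c)

  private
    -- Of two distinct cliques one is not above the other; moving that one to its parent keeps `x`
    -- and lowers the sum of the ranks.
    within′ : ∀ {x} i j → Acc ℕ._<_ (rank i + rank j) → x ∈ C i → x ∈ C j →
      Within asGraph (λ k → x ∈ C k) i j
    within′ i j (acc rec) xi xj with i ≟ j
    ... | yes refl = ε , xi ∷ []
    ... | no i≢j with incomparable i≢j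
    ...   | inj₁ ¬b =
      let i≢r = ¬below⇒≢root ¬b
          xp  = running ¬b xi xj
      in within-trans asGraph (within-edge asGraph (inj₁ (i≢r , refl)) xi xp)
           (within′ (parent i) j (rec (ℕ.+-monoˡ-< (rank j) (descends i≢r))) xp xj)
    ...   | inj₂ ¬b =
      let j≢r = ¬below⇒≢root ¬b
          xp  = running ¬b xj xi
      in within-trans asGraph
           (within′ i (parent j) (rec (ℕ.+-monoʳ-< (rank i) (descends j≢r))) xi xp)
           (within-edge asGraph (inj₂ (j≢r , refl)) xp xj)

  junction : ∀ {i j} (p : Walk asGraph i j) → IsPath asGraph p →
    ∀ {k} → k List.∈ vertices asGraph p → C i ∩ C j ⊆ C k
  junction {i} {j} p p! k∈ x∈ =
    let xi , xj = x∈p∩q⁻ (C i) (C j) x∈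
        w , ps  = within′ i j (<-wellFounded _) xi xj
    in All.lookup ps (path⊆walk asGraph (proj₂ isTree) p w p! k∈)

-- Rooting a tree

module _ {K} (T : Graph K) (isTree : IsTree T) (z : Fin K) where
  open Graph T
  private
    connected = proj₁ isTree
    acyclic : Acyclic T
    acyclic = proj₂ isTree

    Path : Fin K → Fin K → Set
    Path i j = Σ[ p ∈ Walk T i j ] IsPath T p

    pathTo : ∀ i → Path i z
    pathTo i = let p , p! , _ = toPath T (connected i z) in p , p!

    next : ∀ {i j} → Walk T i j → Fin K
    next {i} ε             = i
    next (_◅_ {j = j} _ _) = j

    -- `next` can be read off the vertex list, which is all that `path-unique` determines.
    next-unique : ∀ {i} (p q : Path i z) → next (proj₁ p) ≡ next (proj₁ q)
    next-unique {i} (p , p!) (q , q!) = trans (next≡second p) (trans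
      (cong second (path-unique T acyclic p q p! q!)) (sym (next≡second q)))
      where
      second : List (Fin K) → Fin K
      second (_ ∷ x ∷ _) = x
      second _           = i
      next≡second : (p : Walk T i z) → next p ≡ second (vertices T p)
      next≡second ε             = refl
      next≡second (_ ◅ ε)       = refl
      next≡second (_ ◅ (_ ◅ _)) = refl

    distance : Fin K → ℕ
    distance i = length (vertices T (proj₁ (pathTo i)))

    toward : Fin K → Fin K
    toward i = next (proj₁ (pathTo i))

    toward-spec : ∀ {i} → i ≢ z →
      i ~ toward i × distance (toward i) ℕ.< distance i
    toward-spec {i} i≢z = spec (pathTo i)
      where
      spec : (p : Path i z) → i ~ next (proj₁ p) ×
        distance (next (proj₁ p)) ℕ.< length (vertices T (proj₁ p))
      spec (ε , _) = contradiction refl i≢z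
      spec (_◅_ {j = j} e q , (_ ∷ q!)) = e , s≤s (ℕ.≤-reflexive (cong length
        (path-unique T acyclic (proj₁ (pathTo j)) q (proj₂ (pathTo j)) q!)))

  rootAt : RootedTree K
  rootAt = record
    { root     = z
    ; parent   = toward
    ; rank     = distance
    ; descends = proj₂ ∘ toward-spec
    }

  open RootedTree rootAt

  edge-sound : ∀ {i j} → Edge i j → i ~ j
  edge-sound (inj₁ (i≢z , refl)) = proj₁ (toward-spec i≢z)
  edge-sound (inj₂ (j≢z , refl)) = ~-sym (proj₁ (toward-spec j≢z))

  -- If the path from `j` to the root misses `i`, prepending `i` gives the path of `i`. If it meets
  -- `i`, then `i` is its second vertex: otherwise its piece from the second vertex to `i` would be
  -- a detour around `j`.
  edge-complete : ∀ {i j} → i ~ j → Edge i j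
  edge-complete {i} {j} i~j with pathTo j in eq
  ... | p , p! with Any.any? (i ≟_) (vertices T p)
  ...   | no i∉ = inj₁ ((λ { refl → i∉ (end∈ T p) }) , next-unique
      (i~j ◅ p , All.tabulate (λ x∈ i≡x → i∉ (subst (List._∈ _) (sym i≡x) x∈)) ∷ p!)
      (pathTo i) )
  ...   | yes i∈ = inj₂ (via p p! i∈ eq)
    where
    via : (p : Walk T j z) (p! : IsPath T p) → i List.∈ vertices T p →
      pathTo j ≡ (p , p!) → j ≢ z × i ≡ toward j
    via ε _ (here refl) _ = contradiction i~j (~-irrefl refl)
    via (_ ◅ _) _ (here refl) _ = contradiction i~j (~-irrefl refl)
    via (_◅_ {j = k} e q) (j∉ ∷ q!) (there i∈) eq
      = (λ { refl → All.lookup j∉ (end∈ T q) refl })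
      , trans (i≡k q j∉ i∈) (sym (cong (next ∘ proj₁) eq))
      where
      prefix : ∀ {k} (q : Walk T k z) → All (j ≢_) (vertices T q) →
        i List.∈ vertices T q → Within T (j ≢_) k i
      prefix ε ps (here refl) = ε , ps
      prefix (_ ◅ _) (p ∷ _) (here refl) = ε , p ∷ []
      prefix (e ◅ q) (p ∷ ps) (there i∈) =
        within-trans T (within-edge T e p (start T q ps)) (prefix q ps i∈)
      i≡k : (q : Walk T k z) → All (j ≢_) (vertices T q) → i List.∈ vertices T q → i ≡ k
      i≡k q j∉ i∈ with k ≟ i
      ... | yes k≡i = sym k≡i
      ... | no k≢i = contradiction (prefix q j∉ i∈)
        (no-detour T acyclic e (~-sym i~j) k≢i)

  module _ {n} (C : Fin K → Subset n)
    (junction : ∀ {i j} (p : Walk T i j) → IsPath T p →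
                ∀ {k} → k List.∈ vertices T p → C i ∩ C j ⊆ C k) where

    private
      stays-below : ∀ {i k j} → (w : Walk T k j) → All (i ≢_) (vertices T w) →
        Below i k → Below i j
      stays-below ε _ b = b
      stays-below (e ◅ w) (i≢k ∷ ps) b with edge-complete e
      ... | inj₁ (_ , refl)   = stays-below w ps (proj₂ (below-step i≢k b))
      ... | inj₂ (k≢z , refl) = stays-below w ps (up k≢z b)

      -- After a step to a child the rest of the path avoids `i`, and so it could never leave the
      -- subtree of `i`.
      through-parent : ∀ {i j} → ¬ Below i j → (p : Walk T i j) → IsPath T p →
        toward i List.∈ vertices T p
      through-parent ¬b ε _ = contradiction here ¬b
      through-parent ¬b (e ◅ p) (i∉ ∷ _) with edge-complete e
      ... | inj₁ (_ , refl)   = there (start∈ T p)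
      ... | inj₂ (k≢z , refl) = contradiction (stays-below p i∉ (up k≢z here)) ¬b

    junctionRootedAt : JunctionTree C
    junctionRootedAt = record
      { tree    = rootAt
      ; running = λ {i} {j} ¬b xi xj →
          let p , p! , _ = toPath T (connected i j)
          in junction p p! (through-parent ¬b p p!) (x∈p∩q⁺ (xi , xj))
      }

-- Minimal separators as separators of tree edges

⊆∧⊄⇒≡ : ∀ {n} {S R : Subset n} → S ⊆ R → S ⊄ R → S ≡ R
⊆∧⊄⇒≡ {S = S} S⊆R S⊄R = ⊆-antisym S⊆R λ {x} x∈R →
  decidable-stable (x ∈? S) λ x∉S → S⊄R (S⊆R , x , x∈R , x∉S)

⊈⇒∃ : ∀ {n} {S R : Subset n} → ¬ S ⊆ R → ∃ λ x → x ∈ S × x ∉ R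
⊈⇒∃ {S = S} {R} S⊈R with any? (λ x → (x ∈? S) ×-dec ¬? (x ∈? R))
... | yes found = found
... | no ¬∃ = contradiction
  (λ {x} x∈S → decidable-stable (x ∈? R) λ x∉R → ¬∃ (x , x∈S , x∉R)) S⊈R

module _ {n} {P : Pred (Subset n) 0ℓ} (e : Enumeration P) where

  lookup-correct : ∀ i → P (lookup (elements e) i)
  lookup-correct i = Equivalence.to (correct e _) (∈-lookup i)

  position : ∀ {S} → P S → ∃ λ i → lookup (elements e) i ≡ S
  position pS = let S∈ = Equivalence.from (correct e _) pS
                in Any.index S∈ , sym (lookup-index S∈)

  lookup-injective : ∀ {i j} → lookup (elements e) i ≡ lookup (elements e) j → i ≡ j
  lookup-injective = unique⇒lookup-injective (unique e)

module _ {n} (G : Graph n) where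
  open Graph G

  -- These properties say that `C` lists the maximal cliques, each once, independently of how they
  -- were enumerated.
  record CliqueCover {K} (C : Fin K → Subset n) : Set where
    field
      clique    : ∀ i → IsClique G (C i)
      antichain : ∀ {i j} → C i ⊆ C j → i ≡ j
      covered   : ∀ {R} → IsClique G R → ∃ λ i → R ⊆ C i

  private
    covered′ : ∀ R → Acc (λ p q → q ⊂ p) R → IsClique G R → ∃ λ i → R ⊆ C G i
    covered′ R (acc rec) clique with anySubset? (λ Q → isClique? G Q ×-dec (R ⊂? Q))
    ... | yes (Q , cliqueQ , R⊂Q) =
      let i , Q⊆ = covered′ Q (rec R⊂Q) cliqueQ in i , Q⊆ ∘ p⊂q⇒p⊆q R⊂Q
    ... | no ¬∃ =
      let i , eq = position (maximalCliques G) (clique , λ Q cl R⊂Q → ¬∃ (Q , cl , R⊂Q))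
      in i , λ {x} → subst (x ∈_) (sym eq)

  maximalCliqueCover : CliqueCover (C G)
  maximalCliqueCover = record
    { clique    = proj₁ ∘ lookup-correct (maximalCliques G)
    ; antichain = λ {i} {j} i⊆j → lookup-injective (maximalCliques G)
        (⊆∧⊄⇒≡ i⊆j (proj₂ (lookup-correct (maximalCliques G) i) (C G j)
          (proj₁ (lookup-correct (maximalCliques G) j))))
    ; covered   = covered′ _ (⊃-wellFounded _)
    }

module _ {n} {G : Graph n} {K} {C : Fin K → Subset n} (cover : CliqueCover G C) where
  open Graph G
  open CliqueCover cover

  ∈-covered : ∀ x → ∃ λ i → x ∈ C i
  ∈-covered x = let i , sub = covered single in i , sub (x∈⁅x⁆ x)
    where
    single : IsClique G ⁅ x ⁆
    single u v u∈ v∈ u≢v = contradiction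
      (trans (x∈⁅y⁆⇒x≡y x u∈) (sym (x∈⁅y⁆⇒x≡y x v∈))) u≢v

  ~-covered : ∀ {x y} → x ~ y → ∃ λ i → x ∈ C i × y ∈ C i
  ~-covered {x} {y} x~y =
    let i , sub = covered pair
    in i , sub (x∈p∪q⁺ (inj₁ (x∈⁅x⁆ x))) , sub (x∈p∪q⁺ (inj₂ (x∈⁅x⁆ y)))
    where
    pair : IsClique G (⁅ x ⁆ ∪ ⁅ y ⁆)
    pair u v u∈ v∈ u≢v
      with Sum.map (x∈⁅y⁆⇒x≡y x) (x∈⁅y⁆⇒x≡y y) (x∈p∪q⁻ ⁅ x ⁆ ⁅ y ⁆ u∈)
         | Sum.map (x∈⁅y⁆⇒x≡y x) (x∈⁅y⁆⇒x≡y y) (x∈p∪q⁻ ⁅ x ⁆ ⁅ y ⁆ v∈)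
    ... | inj₁ refl | inj₁ refl = contradiction refl u≢v
    ... | inj₁ refl | inj₂ refl = x~y
    ... | inj₂ refl | inj₁ refl = ~-sym x~y
    ... | inj₂ refl | inj₂ refl = contradiction refl u≢v

  -- Each edge of the walk lies in some clique of the family. Where these cliques change from `P` to
  -- its complement, the current vertex lies in a clique of either kind, hence in `S`.
  crosses : ∀ {S} {P : Pred (Fin K) 0ℓ} → U.Decidable P →
    (∀ {k m} → P k → ¬ P m → ∀ {x} → x ∈ C k → x ∈ C m → x ∈ S) →
    ∀ {a b i j} (w : Walk G a b) → P i → ¬ P j → a ∈ C i → b ∈ C j →
    Any (_∈ S) (vertices G w)
  crosses P? meet ε pi ¬pj ai aj = here (meet pi ¬pj ai aj)
  crosses P? meet (e ◅ w) pi ¬pj ai bj with ~-covered e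
  ... | m , am , ym with P? m
  ...   | yes pm = there (crosses P? meet w pm ¬pj ym bj)
  ...   | no ¬pm = here (meet pi ¬pm ai am)

  clique-within : ∀ {S i x y} → x ∈ C i → y ∈ C i → x ∉ S → y ∉ S → Within G (_∉ S) x y
  clique-within {i = i} {x} {y} xi yi x∉ y∉ with x ≟ y
  ... | yes refl = ε , x∉ ∷ []
  ... | no x≢y   = within-edge G (clique i x y xi yi x≢y) x∉ y∉

  module _ (J : JunctionTree C) where
    open JunctionTree J

    -- As neither of the two cliques contains the other, each has a vertex outside the other. Every
    -- walk between these crosses the edge, and any `s` dropped from the separator is adjacent to
    -- both.
    separator-minimal : ∀ {e} → e ≢ root → IsMinimalSeparator G (separator e)
    separator-minimal {e} e≢r
      with ⊈⇒∃ (parent-≢ e≢r ∘ antichain) | ⊈⇒∃ (parent-≢ e≢r ∘ sym ∘ antichain)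
    ... | a , ae , a∉p | b , bp , b∉e =
      a , b , (λ { refl → a∉p bp }) , ¬a~b , separates , minimal
      where
      S = separator e
      a∉S : a ∉ S
      a∉S = a∉p ∘ p∩q⊆q _ _
      b∉S : b ∉ S
      b∉S = b∉e ∘ p∩q⊆p _ _
      hits : (w : Walk G a b) → Any (_∈ S) (vertices G w)
      hits w = crosses (below? e) leave w here (¬below-parent e≢r) ae bp
      separates : Separates G S a b
      separates = a∉S , b∉S , hits
      ¬a~b : ¬ a ~ b
      ¬a~b a~b = All¬⇒¬Any (a∉S ∷ b∉S ∷ []) (hits (a~b ◅ ε))
      minimal : ∀ R → R ⊂ S → ¬ Separates G R a b
      minimal R (R⊆S , s , s∈S , s∉R) (_ , _ , sep) =
        let se , sp = x∈p∩q⁻ (C e) _ s∈S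
            w , avoids = within-trans G
              (clique-within ae se (a∉S ∘ R⊆S) s∉R) (clique-within sp bp s∉R (b∉S ∘ R⊆S))
        in All¬⇒¬Any avoids (sep w)

    private
      Stuck : Subset n → Fin K → Set
      Stuck S i = i ≢ root → separator i ⊆ S

      SameSide : Subset n → Fin K → Fin K → Set
      SameSide S i j = ∀ {e} → e ≢ root → separator e ⊆ S → Below e i ⇔ Below e j

      ascend : ∀ {S} i → Acc ℕ._<_ (rank i) → ∀ {x} → x ∈ C i → x ∉ S →
        ∃₂ λ i′ x′ → x′ ∈ C i′ × x′ ∉ S × Within G (_∉ S) x x′ × Stuck S i′ × SameSide S i i′
      ascend {S} i (acc rec) {x} xi x∉ with i ≟ root | separator i ⊆? S
      ... | yes i≡r | _ = i , x , xi , x∉ , (ε , x∉ ∷ []) , (λ i≢r → contradiction i≡r i≢r) ,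
        λ _ _ → mk⇔ id id
      ... | no _ | yes sub = i , x , xi , x∉ , (ε , x∉ ∷ []) , (λ _ → sub) , λ _ _ → mk⇔ id id
      ... | no i≢r | no ⊈S =
        let y , y∈ , y∉ = ⊈⇒∃ ⊈S
            yi , yp = x∈p∩q⁻ (C i) _ y∈
            i′ , x′ , x′i′ , x′∉ , w , stuck , same = ascend (parent i) (rec (descends i≢r)) yp y∉
        in i′ , x′ , x′i′ , x′∉ , within-trans G (clique-within xi yi x∉ y∉) w , stuck ,
           -- The edge just climbed has its separator not inside `S`, so it is not `e`, and the move
           -- changes no side that is recorded.
           λ e≢r sub → mk⇔
             (λ b → Equivalence.to (same e≢r sub)
               (proj₂ (below-step (λ { refl → ⊈S sub }) b)))
             (λ b → up i≢r (Equivalence.from (same e≢r sub) b))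

      -- A stuck `i` is itself among the edges compared by `SameSide`, so the trivial `Below i i`
      -- carries over to `j`.
      stuck-below : ∀ {S i j} → Stuck S i → SameSide S i j → Below i j
      stuck-below {i = i} stuck same with i ≟ root
      ... | yes refl = root-below _
      ... | no i≢r   = Equivalence.to (same i≢r (stuck i≢r)) here

      same-trans : ∀ {S i j k} → SameSide S i j → SameSide S j k → SameSide S i k
      same-trans f g e≢r sub = mk⇔
        (Equivalence.to (g e≢r sub) ∘ Equivalence.to (f e≢r sub))
        (Equivalence.from (f e≢r sub) ∘ Equivalence.from (g e≢r sub))

      same-sym : ∀ {S i j} → SameSide S i j → SameSide S j i
      same-sym f e≢r sub = mk⇔ (Equivalence.from (f e≢r sub)) (Equivalence.to (f e≢r sub))

      -- Climb from both cliques as long as the next separator is not inside S;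
      -- two cliques on the same side of all separators inside S end up in one clique.
      connects : ∀ {S i j a b} → SameSide S i j → a ∈ C i → b ∈ C j → a ∉ S → b ∉ S →
        Within G (_∉ S) a b
      connects {i = i} {j} same ai bj a∉ b∉
        with ascend i (<-wellFounded _) ai a∉ | ascend j (<-wellFounded _) bj b∉
      ... | i′ , x , xi , x∉ , v , stuckᵢ , sameᵢ | j′ , y , yj , y∉ , w , stuckⱼ , sameⱼ
        with same-trans (same-sym sameᵢ) (same-trans same sameⱼ)
      ... | same′ with below-antisym (stuck-below stuckᵢ same′) (stuck-below stuckⱼ (same-sym same′))
      ... | refl = within-trans G v
        (within-trans G (clique-within xi yj x∉ y∉) (within-sym G w))

      Distinguishes : Fin K → Fin K → Fin K → Set
      Distinguishes i j e = (Below e i × ¬ Below e j) ⊎ (¬ Below e i × Below e j)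

      ¬distinguishes : ∀ {i j e} → ¬ Distinguishes i j e → Below e i ⇔ Below e j
      ¬distinguishes {i} {j} {e} ¬d = mk⇔
        (λ bi → decidable-stable (below? e j) λ ¬bj → ¬d (inj₁ (bi , ¬bj)))
        (λ bj → decidable-stable (below? e i) λ ¬bi → ¬d (inj₂ (¬bi , bj)))

    -- Some edge with separator inside `S` has the cliques of `a` and `b` on different sides, or
    -- `connects` would avoid `S`. Its separator already separates `a` from `b`, so minimality makes
    -- it all of `S`.
    minimal-separator : ∀ {S} → IsMinimalSeparator G S → ∃ λ e → e ≢ root × separator e ≡ S
    minimal-separator {S} (a , b , _ , _ , (a∉S , b∉S , sep) , minimal)
      with ∈-covered a | ∈-covered b
    ... | i , ai | j , bj
      with any? (λ e → ¬? (e ≟ root) ×-dec ((separator e ⊆? S) ×-dec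
             (((below? e i) ×-dec ¬? (below? e j)) ⊎-dec (¬? (below? e i) ×-dec (below? e j)))))
    ... | no ¬∃ =
      let w , avoids = connects
            (λ e≢r sub → ¬distinguishes λ d → ¬∃ (_ , e≢r , sub , d)) ai bj a∉S b∉S
      in contradiction (sep w) (All¬⇒¬Any avoids)
    ... | yes (e , e≢r , sub , d) = e , e≢r , ⊆∧⊄⇒≡ sub λ ⊂S →
      minimal (separator e) ⊂S (a∉S ∘ sub , b∉S ∘ sub , hits d)
      where
      hits : Distinguishes i j e → (w : Walk G a b) → Any (_∈ separator e) (vertices G w)
      hits (inj₁ (bi , ¬bj)) w = crosses (below? e) leave w bi ¬bj ai bj
      -- Here the walk enters the subtree of `e`, so the side to be left is its complement.
      hits (inj₂ (¬bi , bj′)) w = crosses (¬? ∘ below? e)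
        (λ ¬bk ¬¬bm xk xm → leave (decidable-stable (below? e _) ¬¬bm) ¬bk xm xk)
        w ¬bi (λ ¬bj → ¬bj bj′) ai bj

    -- Counting separators against edges

    InjectiveSeparators : Set
    InjectiveSeparators = ∀ {k l} → k ≢ root → l ≢ root → separator k ≡ separator l → k ≡ l

    module _ (E : Enumeration (IsMinimalSeparator G)) where

      private
        𝒮ᵢ : Fin (size E) → Subset n
        𝒮ᵢ = lookup (elements E)

        choose : ∀ s → ∃ λ e → e ≢ root × separator e ≡ 𝒮ᵢ s
        choose s = minimal-separator (lookup-correct E s)

        number : ∀ {k} → k ≢ root → ∃ λ s → 𝒮ᵢ s ≡ separator k
        number k≢r = position E (separator-minimal k≢r)

        choose-injective : (f : ∀ s → ∃ λ e → e ≢ root × separator e ≡ 𝒮ᵢ s) →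
          ∀ {s t} → proj₁ (f s) ≡ proj₁ (f t) → s ≡ t
        choose-injective f {s} {t} eq = lookup-injective E
          (trans (sym (proj₂ (proj₂ (f s)))) (trans (cong separator eq) (proj₂ (proj₂ (f t)))))

      -- One edge is chosen for each separator; `root`, which names no edge, supplies the extra
      -- element.
      size< : suc (size E) ℕ.≤ K
      size< = injective⇒≤ {f = f} λ {s} {t} → f-inj s t
        where
        f : Fin (suc (size E)) → Fin K
        f zero    = root
        f (suc s) = proj₁ (choose s)
        f-inj : ∀ s t → f s ≡ f t → s ≡ t
        f-inj zero    zero    _  = refl
        f-inj zero    (suc t) eq = contradiction (sym eq) (proj₁ (proj₂ (choose t)))
        f-inj (suc s) zero    eq = contradiction eq (proj₁ (proj₂ (choose s)))
        f-inj (suc s) (suc t) eq = cong suc (choose-injective choose eq)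

      -- Choosing `k` wherever `l` was chosen leaves `l` as a second spare element beside `root`.
      collision⇒< : ∀ {k l} → k ≢ root → l ≢ root → k ≢ l → separator k ≡ separator l →
        suc (suc (size E)) ℕ.≤ K
      collision⇒< {k} {l} k≢r l≢r k≢l eq = injective⇒≤ {f = f} λ {s} {t} → f-inj s t
        where
        choose′ : ∀ s → ∃ λ e → (e ≢ root × separator e ≡ 𝒮ᵢ s) × e ≢ l
        choose′ s with choose s
        ... | e , e≢r , e≡ with e ≟ l
        ...   | yes refl = k , (k≢r , trans eq e≡) , k≢l
        ...   | no e≢l   = e , (e≢r , e≡) , e≢l
        chosen : ∀ s → ∃ λ e → e ≢ root × separator e ≡ 𝒮ᵢ s
        chosen s = proj₁ (choose′ s) , proj₁ (proj₂ (choose′ s))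
        f : Fin (suc (suc (size E))) → Fin K
        f zero          = root
        f (suc zero)    = l
        f (suc (suc s)) = proj₁ (choose′ s)
        f-inj : ∀ s t → f s ≡ f t → s ≡ t
        f-inj zero          zero          _  = refl
        f-inj zero          (suc zero)    eq = contradiction (sym eq) l≢r
        f-inj zero          (suc (suc t)) eq = contradiction (sym eq) (proj₁ (proj₂ (chosen t)))
        f-inj (suc zero)    zero          eq = contradiction eq l≢r
        f-inj (suc zero)    (suc zero)    _  = refl
        f-inj (suc zero)    (suc (suc t)) eq = contradiction (sym eq) (proj₂ (proj₂ (choose′ t)))
        f-inj (suc (suc s)) zero          eq = contradiction eq (proj₁ (proj₂ (chosen s)))
        f-inj (suc (suc s)) (suc zero)    eq = contradiction eq (proj₂ (proj₂ (choose′ s)))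
        f-inj (suc (suc s)) (suc (suc t)) eq = cong (λ u → suc (suc u)) (choose-injective chosen eq)

      injective⇒≤size : InjectiveSeparators → K ℕ.≤ suc (size E)
      injective⇒≤size inj = injective⇒≤ {f = f} λ {k} {l} → f-inj k l
        where
        f : Fin K → Fin (suc (size E))
        f k with k ≟ root
        ... | yes _  = zero
        ... | no k≢r = suc (proj₁ (number k≢r))
        f-inj : ∀ k l → f k ≡ f l → k ≡ l
        f-inj k l eq with k ≟ root | l ≟ root
        f-inj k l eq | yes k≡r | yes l≡r = trans k≡r (sym l≡r)
        f-inj k l eq | no k≢r  | no l≢r  = inj k≢r l≢r
          (trans (sym (proj₂ (number k≢r)))
            (trans (cong 𝒮ᵢ (suc-injective eq)) (proj₂ (number l≢r))))

      size≡⇔injective : (size E ≡ K ∸ 1) ⇔ InjectiveSeparators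
      size≡⇔injective = mk⇔
        (λ size≡ {k} {l} k≢r l≢r eq → decidable-stable (k ≟ l) λ k≢l → ℕ.1+n≰n
          (ℕ.≤-trans (collision⇒< k≢r l≢r k≢l eq)
            (subst (λ m → K ℕ.≤ suc m) (sym size≡) (ℕ.m≤n+m∸n (K) 1))))
        (λ inj → ℕ.≤-antisym (ℕ.∸-monoˡ-≤ 1 size<) (ℕ.∸-monoˡ-≤ 1 (injective⇒≤size inj)))

-- Exchanging an edge, and forced edges

module _ {K n} {C : Fin K → Subset n} (J : JunctionTree C) where
  open JunctionTree J

  child-toward : ∀ {i l} → Below i l → i ≢ l → ∃ λ m → m ≢ root × parent m ≡ i × Below m l
  child-toward here i≢l = contradiction refl i≢l
  child-toward {i} (up {l} l≢r b) _ with i ≟ parent l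
  ... | yes i≡p = l , l≢r , sym i≡p , here
  ... | no i≢p  =
    let m , m≢r , pm≡i , b′ = child-toward b i≢p in m , m≢r , pm≡i , up l≢r b′

  -- The vertices of `separator k` lie in every clique between edge `k` and edge `l`; so x - y is
  -- edge `k`, and `z` is the next clique toward edge `l`. The cases tell where that is: above
  -- `parent k`, at another child of `parent k`, or at a child of `k` if `l` is below `k`.
  nested⇒adjacent : ∀ {k l} → k ≢ root → l ≢ root → k ≢ l → separator k ⊆ separator l →
    ∃₂ λ x y → ∃ λ z → Edge x y × Edge y z × x ≢ z × C x ∩ C y ⊆ C z
  nested⇒adjacent {k} {l} k≢r l≢r k≢l nested with below? (parent k) l
  ... | no ¬b = k , parent k , parent (parent k) ,
    inj₁ (k≢r , refl) , inj₁ (p≢r , refl) ,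
    (λ k≡ → ℕ.<-asym (descends k≢r) (subst (λ z → rank z ℕ.< rank (parent k)) (sym k≡) (descends p≢r))) ,
    λ x∈ → running ¬b (p∩q⊆q _ _ x∈) (p∩q⊆p _ _ (nested x∈))
    where
    p≢r : parent k ≢ root
    p≢r = ¬below⇒≢root ¬b
  ... | yes b with parent k ≟ l
  ...   | yes refl = k , l , parent l ,
    inj₁ (k≢r , refl) , inj₁ (l≢r , refl) ,
    (λ k≡ → ℕ.<-asym (descends k≢r) (subst (λ z → rank z ℕ.< rank l) (sym k≡) (descends l≢r))) ,
    λ x∈ → p∩q⊆q _ _ (nested x∈)
  ...   | no p≢l with child-toward b p≢l
  ...     | m , m≢r , pm≡pk , b′ with m ≟ k
  ...       | no m≢k = k , parent k , m ,
    inj₁ (k≢r , refl) , inj₂ (m≢r , sym pm≡pk) , m≢k ∘ sym ,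
    λ {x} x∈ → p∩q⊆p _ _ (leave b′ (¬below-parent m≢r)
      (p∩q⊆p _ _ (nested x∈)) (subst (λ z → x ∈ C z) (sym pm≡pk) (p∩q⊆q _ _ x∈)))
  ...       | yes refl with child-toward b′ k≢l
  ...         | m′ , m′≢r , refl , b″ = parent k , k , m′ ,
    inj₂ (k≢r , refl) , inj₂ (m′≢r , refl) ,
    (λ eq → ℕ.<-asym (descends m′≢r) (subst (λ z → rank z ℕ.< rank k) eq (descends k≢r))) ,
    λ x∈ → let xp , xk = x∈p∩q⁻ (C (parent k)) (C k) x∈ in
      p∩q⊆p _ _ (leave b″ (¬below-parent m′≢r) (p∩q⊆p _ _ (nested (x∈p∩q⁺ (xk , xp)))) xk)

  -- Replacing the tree edge x – y by x – root, where x – y – root is a path.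
  module Reattach {x y} (x≢r : x ≢ root) (y≢r : y ≢ root) (px≡y : parent x ≡ y)
    (py≡r : parent y ≡ root) (sub : C x ∩ C y ⊆ C root) where

    private
      x≢y : x ≢ y
      x≢y x≡y = parent-≢ x≢r (trans x≡y (sym px≡y))

      parent′ : Fin K → Fin K
      parent′ i with i ≟ x
      ... | yes _ = root
      ... | no _  = parent i

      parent′-x : parent′ x ≡ root
      parent′-x with x ≟ x
      ... | yes _  = refl
      ... | no x≢x = contradiction refl x≢x

      parent′-other : ∀ {i} → i ≢ x → parent′ i ≡ parent i
      parent′-other {i} i≢x with i ≟ x
      ... | yes i≡x = contradiction i≡x i≢x
      ... | no _    = refl

      descends′ : ∀ {i} → i ≢ root → rank (parent′ i) ℕ.< rank i
      descends′ {i} i≢r with i ≟ x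
      ... | no _     = descends i≢r
      -- The new parent of `x` was its grandparent, so the old ranks still descend.
      ... | yes refl = ℕ.<-trans
        (subst₂ (λ u v → rank u ℕ.< rank v) py≡r (sym px≡y) (descends y≢r)) (descends x≢r)

    tree′ : RootedTree K
    tree′ = record { root = root ; parent = parent′ ; rank = rank ; descends = descends′ }

    private
      module R = RootedTree tree′

      -- Only `y` loses descendants. A climb through `x` now skips `y`, which does no harm unless it
      -- was to end there.
      below⇒below′ : ∀ {i j} → i ≢ y → Below i j → R.Below i j
      below⇒below′ i≢y here = R.here
      below⇒below′ {i} i≢y (up {j} j≢r b) with below⇒below′ i≢y b | j ≟ x
      ... | b′ | no j≢x = R.up j≢r (subst (R.Below i) (sym (parent′-other j≢x)) b′)
      ... | b′ | yes refl = R.up j≢r (subst (R.Below i)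
        (trans (parent′-other (x≢y ∘ sym)) (trans py≡r (sym parent′-x)))
        (proj₂ (R.below-step i≢y (subst (R.Below i) px≡y b′))))

      below-y : ∀ {j} → Below y j → R.Below y j ⊎ Below x j
      below-y here = inj₁ R.here
      below-y (up {j} j≢r b) with j ≟ x | below-y b
      ... | yes refl | _       = inj₂ here
      ... | no j≢x   | inj₁ b′ = inj₁ (R.up j≢r (subst (R.Below y) (sym (parent′-other j≢x)) b′))
      ... | no _     | inj₂ b′ = inj₂ (up j≢r b′)

      ¬x-above-y : ¬ Below x y
      ¬x-above-y = subst (λ z → ¬ Below x z) px≡y (¬below-parent x≢r)

      running′ : ∀ {i j} → ¬ R.Below i j → ∀ {v} → v ∈ C i → v ∈ C j → v ∈ C (parent′ i)
      running′ {i} {j} ¬b {v} vi vj with i ≟ x | i ≟ y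
      ... | yes refl | _ = sub (x∈p∩q⁺ (vi , subst (λ z → v ∈ C z) px≡y
        (running (¬b ∘ below⇒below′ x≢y) vi vj)))
      ... | no _ | no i≢y = running (¬b ∘ below⇒below′ i≢y) vi vj
      ... | no _ | yes refl with below? i j
      ...   | no ¬b′ = running ¬b′ vi vj
      ...   | yes b with below-y b
      ...     | inj₁ b′ = contradiction b′ ¬b
      -- The clique `j` went with `x` out of the subtree of `y`. What it shares with `C y` lies in
      -- `C x` too, so `sub` applies.
      ...     | inj₂ b′ = subst (λ z → v ∈ C z) (sym py≡r)
        (sub (x∈p∩q⁺ (p∩q⊆p _ _ (leave b′ ¬x-above-y vj vi) , vi)))

    reattached : JunctionTree C
    reattached = record { tree = tree′ ; running = running′ }

    reattached-edge : R.Edge x root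
    reattached-edge = inj₁ (x≢r , sym parent′-x)

-- Every separator on the path from i to j contains S, so by injectivity the path is one edge.
module _ {K n} {C : Fin K → Subset n} (J : JunctionTree C) where
  open JunctionTree J

  private
    forced′ : ∀ {S i j} → S ⊆ C i → S ⊆ C j →
      (∀ {e} → e ≢ root → S ⊆ separator e → S ≡ separator e) →
      (∀ {k l} → k ≢ root → l ≢ root → separator k ≡ separator l → k ≡ l) →
      ¬ Below i j → parent i ≡ j
    forced′ {S} {i} {j} Si Sj only inj ¬b with parent i ≟ j
    ... | yes p≡j = p≡j
    -- The path then has a second edge, above `parent i` or above `j`. Its separator is `S` as well,
    -- so injectivity would make it the edge above `i`.
    ... | no p≢j with incomparable p≢j
    ...   | inj₁ ¬b′ =
      let i≢r = ¬below⇒≢root ¬b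
          p≢r = ¬below⇒≢root ¬b′
          Sp : S ⊆ C (parent i)
          Sp = λ s → running ¬b (Si s) (Sj s)
          Spp = λ {x} (s : x ∈ S) → running ¬b′ (Sp s) (Sj s)
      in contradiction
        (inj i≢r p≢r (trans (sym (only i≢r λ s → x∈p∩q⁺ (Si s , Sp s)))
                            (only p≢r λ s → x∈p∩q⁺ (Sp s , Spp s))))
        (parent-≢ i≢r)
    ...   | inj₂ ¬b′ =
      let i≢r = ¬below⇒≢root ¬b
          j≢r = ¬below⇒≢root ¬b′
          Sp : S ⊆ C (parent i)
          Sp = λ s → running ¬b (Si s) (Sj s)
          Spj = λ {x} (s : x ∈ S) → running ¬b′ (Sj s) (Sp s)
      in contradiction
        (subst (Below i) (inj i≢r j≢r (trans (sym (only i≢r λ s → x∈p∩q⁺ (Si s , Sp s)))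
                            (only j≢r λ s → x∈p∩q⁺ (Sj s , Spj s)))) here)
        ¬b

  forced-edge : ∀ {S i j} → i ≢ j → S ⊆ C i → S ⊆ C j →
    (∀ {e} → e ≢ root → S ⊆ separator e → S ≡ separator e) →
    (∀ {k l} → k ≢ root → l ≢ root → separator k ≡ separator l → k ≡ l) →
    Edge i j
  forced-edge i≢j Si Sj only inj with incomparable i≢j
  ... | inj₁ ¬b = inj₁ (¬below⇒≢root ¬b , sym (forced′ Si Sj only inj ¬b))
  ... | inj₂ ¬b = inj₂ (¬below⇒≢root ¬b , sym (forced′ Sj Si only inj ¬b))

-- Simplicial vertices of chordal graphs

module _ {n} {P : Pred (Fin n) 0ℓ} (P? : U.Decidable P) where

  comprehension : Subset n
  comprehension = tabulate (does ∘ P?)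

  ∈-comprehension⁺ : ∀ {x} → P x → x ∈ comprehension
  ∈-comprehension⁺ {x} px = lookup⇒[]= x comprehension
    (trans (lookup∘tabulate (does ∘ P?) x) (dec-true (P? x) px))

  ∈-comprehension⁻ : ∀ {x} → x ∈ comprehension → P x
  ∈-comprehension⁻ {x} x∈
    with P? x | trans (sym (lookup∘tabulate (does ∘ P?) x)) ([]=⇒lookup x∈)
  ... | yes px | _ = px
  ... | no _   | ()

module _ {n} (G : Graph n) (chordal : Chordal G) where
  open Graph G

  -- Simplicial in the subgraph induced by `W`; the graph stays fixed and only `W` shrinks.
  Simplicial : Subset n → Fin n → Set
  Simplicial W u = ∀ {s t} → s ∈ W → t ∈ W → u ~ s → u ~ t → s ≢ t → s ~ t

  private
    -- Dirac: D is the component of y outside the closed neighbourhood of x, and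
    -- its border in W is a clique by chordality.
    module Dirac (W : Subset n) {x y} (x∈W : x ∈ W) (y∈W : y ∈ W) (x≢y : x ≢ y) (x≁y : ¬ x ~ y) where

      Far : Fin n → Set
      Far z = z ∈ W × x ≢ z × ¬ x ~ z

      far? : U.Decidable Far
      far? z = (z ∈? W) ×-dec (¬? (x ≟ z) ×-dec ¬? (x ~? z))

      -- A component is defined by the set it avoids; avoiding everything outside `W` too keeps it
      -- inside the induced subgraph.
      near : Subset n
      near = ∁ (comprehension far?)

      ∉near⇒far : ∀ {z} → z ∉ near → Far z
      ∉near⇒far = ∈-comprehension⁻ far? ∘ x∉∁p⇒x∈p

      far⇒∉near : ∀ {z} → Far z → z ∉ near
      far⇒∉near far z∈ = x∈∁p⇒x∉p z∈ (∈-comprehension⁺ far? far)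

      open Component (component G near y (far⇒∉near (y∈W , x≢y , x≁y))) public

      D⇒far : ∀ {z} → z ∈ D → Far z
      D⇒far z∈D = let w , avoids = sound z∈D in ∉near⇒far (start G w avoids)

      Bordered : Fin n → Set
      Bordered z = z ∈ W × (z ∈ D ⊎ ∃ λ a → a ∈ D × a ~ z)

      bordered? : U.Decidable Bordered
      bordered? z = (z ∈? W) ×-dec ((z ∈? D) ⊎-dec any? (λ a → (a ∈? D) ×-dec (a ~? z)))

      W′ : Subset n
      W′ = comprehension bordered?

      D⊆W′ : D ⊆ W′
      D⊆W′ z∈D = ∈-comprehension⁺ bordered? (proj₁ (D⇒far z∈D) , inj₁ z∈D)

      W′⊂W : W′ ⊂ W
      W′⊂W = proj₁ ∘ ∈-comprehension⁻ bordered? , x , x∈W , x∉ ∘ ∈-comprehension⁻ bordered?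
        where
        x∉ : ¬ Bordered x
        x∉ (_ , inj₁ x∈D) = proj₁ (proj₂ (D⇒far x∈D)) refl
        x∉ (_ , inj₂ (a , a∈D , a~x)) = proj₂ (proj₂ (D⇒far a∈D)) (~-sym a~x)

      border : ∀ {z} → z ∈ W′ → z ∉ D → x ~ z × ∃ λ a → a ∈ D × a ~ z
      border {z} z∈W′ z∉D with ∈-comprehension⁻ bordered? z∈W′
      ... | _   , inj₁ z∈D = contradiction z∈D z∉D
      ... | z∈W , inj₂ (a , a∈D , a~z) = decidable-stable (x ~? z) (λ x≁z →
        z∉D (closed a∈D a~z (far⇒∉near (z∈W ,
          (λ { refl → proj₂ (proj₂ (D⇒far a∈D)) (~-sym a~z) }) , x≁z)))) , a , a∈D , a~z

      -- Both vertices are neighbours of `x`, and a walk through `D` joins them with all inner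
      -- vertices far from `x`.
      border-clique : ∀ {s t} → s ∈ W′ → t ∈ W′ → s ∉ D → t ∉ D → s ≢ t → s ~ t
      border-clique {s} {t} s∈ t∈ s∉ t∉ s≢t =
        let x~s , a , a∈D , a~s = border s∈ s∉
            x~t , b , b∈D , b~t = border t∈ t∉
            toA = within-map G inner (sound a∈D)
            toB = within-map G inner (sound b∈D)
            w , ps = within-trans G
              (within-edge G (~-sym a~s) (inj₁ refl) (start G (proj₁ toA) (proj₂ toA)))
              (within-trans G toA (within-trans G (within-sym G toB)
                (within-edge G b~t (start G (proj₁ toB) (proj₂ toB)) (inj₂ (inj₁ refl)))))
        in neighbours-adjacent G chordal x~s x~t s≢t w ps
        where
        inner : ∀ {z} → z ∉ near → z ≡ s ⊎ z ≡ t ⊎ (x ≢ z × ¬ x ~ z)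
        inner z∉ = inj₂ (inj₂ (proj₂ (∉near⇒far z∉)))

      simplicial-extends : ∀ {u} → u ∈ D → Simplicial W′ u → Simplicial W u
      simplicial-extends u∈D simp s∈W t∈W u~s u~t =
        simp (∈-comprehension⁺ bordered? (s∈W , inj₂ (_ , u∈D , u~s)))
             (∈-comprehension⁺ bordered? (t∈W , inj₂ (_ , u∈D , u~t))) u~s u~t

  -- Prescribing the vertex `x` to be avoided is what makes the induction work: of two distinct
  -- non-adjacent vertices of `W′`, at least one is in `D`, as the border is a clique. For a vertex
  -- of `D`, all neighbours in `W` lie in `W′`.
  dirac : ∀ W → Acc _⊂_ W → ∀ {x y} → x ∈ W → y ∈ W → x ≢ y → ¬ x ~ y →
    ∃ λ u → u ∈ W × x ≢ u × ¬ x ~ u × Simplicial W u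
  dirac W (acc rec) {x} {y} x∈W y∈W x≢y x≁y = conclude inD
    where
    open Dirac W x∈W y∈W x≢y x≁y

    conclude : (∃ λ u → u ∈ D × Simplicial W′ u) → ∃ λ u → u ∈ W × x ≢ u × ¬ x ~ u × Simplicial W u
    conclude (u , u∈D , simp) = let u∈W , x≢u , x≁u = D⇒far u∈D
      in u , u∈W , x≢u , x≁u , simplicial-extends u∈D simp

    ih : ∀ {p q} → p ∈ W′ → q ∈ W′ → p ≢ q → ¬ p ~ q →
      ∃ λ u → u ∈ W′ × p ≢ u × ¬ p ~ u × Simplicial W′ u
    ih = dirac W′ (rec W′⊂W)

    inD : ∃ λ u → u ∈ D × Simplicial W′ u
    inD with any? (λ p → any? (λ q → (p ∈? W′) ×-dec ((q ∈? D) ×-dec (¬? (p ≟ q) ×-dec ¬? (p ~? q)))))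
    ... | no ¬∃ = y , b∈D , simp
      where
      joined : ∀ {p q} → p ∈ W′ → q ∈ D → p ≢ q → p ~ q
      joined {p} {q} p∈ q∈ p≢q = decidable-stable (p ~? q) λ p≁q →
        ¬∃ (p , q , p∈ , q∈ , p≢q , p≁q)
      simp : Simplicial W′ y
      simp {s} {t} s∈ t∈ _ _ s≢t with s ∈? D | t ∈? D
      ... | yes s∈D | _       = ~-sym (joined t∈ s∈D (s≢t ∘ sym))
      ... | no _    | yes t∈D = joined s∈ t∈D s≢t
      ... | no s∉D  | no t∉D  = border-clique s∈ t∈ s∉D t∉D s≢t
    ... | yes (p , q , p∈ , q∈ , p≢q , p≁q) with ih p∈ (D⊆W′ q∈) p≢q p≁q
    ...   | u , u∈ , p≢u , p≁u , simp with u ∈? D | p ∈? D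
    ...     | yes u∈D | _      = u , u∈D , simp
    ...     | no u∉D  | no p∉D = contradiction (border-clique p∈ u∈ p∉D u∉D p≢u) p≁u
    -- Here `u` is on the border, so a simplicial vertex not adjacent to `u` must be in `D`.
    ...     | no u∉D  | yes p∈D with ih u∈ p∈ (p≢u ∘ sym) (p≁u ∘ ~-sym)
    ...       | v , v∈ , u≢v , u≁v , simp′ with v ∈? D
    ...         | yes v∈D = v , v∈D , simp′
    ...         | no v∉D  = contradiction (border-clique u∈ v∈ u∉D v∉D u≢v) u≁v

-- Lists in which the meet of each member with all later members lies in one later member.
data Running {n : ℕ} : List (Subset n) → Set where
  [_]    : ∀ c → Running (c ∷ [])
  attach : ∀ {c d L} → d List.∈ L → (∀ {e} → e List.∈ L → ∀ {x} → x ∈ c → x ∈ e → x ∈ d) →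
           c List.∉ L → Running L → Running (c ∷ L)

module _ {n : ℕ} where

  running-lookup : ∀ {L : List (Subset n)} → Running L → ∀ i →
    (suc (toℕ i) ≡ length L) ⊎
    (∃ λ p → toℕ i ℕ.< toℕ p × ∀ {j} → toℕ i ℕ.< toℕ j →
      ∀ {x} → x ∈ lookup L i → x ∈ lookup L j → x ∈ lookup L p)
  running-lookup [ c ] zero = inj₁ refl
  running-lookup (attach {L = L} d∈ meets _ _) zero = inj₂ (suc (Any.index d∈) , s≤s z≤n ,
    λ { {suc j} _ {x} xi xj → subst (x ∈_) (lookup-index d∈) (meets (∈-lookup j) xi xj) })
  running-lookup (attach _ _ _ running) (suc i) with running-lookup running i
  ... | inj₁ last = inj₁ (cong suc last)
  ... | inj₂ (p , i<p , meets) = inj₂ (suc p , s≤s i<p ,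
    λ { {suc j} (s≤s i<j) xi xj → meets {j} i<j xi xj })

  running-unique : ∀ {L : List (Subset n)} → Running L → Unique L
  running-unique [ c ] = [] ∷ []
  running-unique (attach {L = L} _ _ c∉ running) =
    All.tabulate (λ d∈ c≡d → c∉ (subst (List._∈ L) (sym c≡d) d∈)) ∷ running-unique running

  -- By `meet`, images of distinct members share only what the members shared, so each attachment
  -- survives.
  running-map : (f : Subset n → Subset n) → (∀ c → c ⊆ f c) → ∀ {L} →
    (∀ {c d} → c List.∈ L → d List.∈ L → c ≢ d → ∀ {x} → x ∈ f c → x ∈ f d → x ∈ c × x ∈ d) →
    (∀ {c d} → c List.∈ L → d List.∈ L → f c ≡ f d → c ≡ d) →
    Running L → Running (map f L)
  running-map f grows meet inj [ c ] = [ f c ]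
  running-map f grows meet inj (attach {c} {d} {L} d∈ meets c∉ running) = attach
    (∈-map⁺ f d∈)
    (λ e∈ xc xe → absorbed (∈-map⁻ f e∈) xc xe)
    (λ fc∈ → let e , e∈ , eq = ∈-map⁻ f fc∈ in
      c∉ (subst (List._∈ L) (sym (inj (here refl) (there e∈) eq)) e∈))
    (running-map f grows (λ c∈ d∈ → meet (there c∈) (there d∈))
      (λ c∈ d∈ → inj (there c∈) (there d∈)) running)
    where
    absorbed : ∀ {e′} → (∃ λ e → e List.∈ L × e′ ≡ f e) → ∀ {x} → x ∈ f c → x ∈ e′ → x ∈ f d
    absorbed (e , e∈ , refl) xc xe =
      let xc′ , xe′ = meet (here refl) (there e∈) (λ { refl → c∉ e∈ }) xc xe
      in grows d (meets e∈ xc′ xe′)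

-- Listing the maximal cliques by adding simplicial vertices

module _ {n} (G : Graph n) where
  open Graph G

  -- The maximal cliques of the subgraph induced by `W`, maximality being expressed by `covers` and
  -- `antichain`.
  record RunningCliques (W : Subset n) : Set where
    field
      list      : List (Subset n)
      running   : Running list
      clique    : ∀ {c} → c List.∈ list → IsClique G c
      within    : ∀ {c} → c List.∈ list → c ⊆ W
      covers    : ∀ {R} → IsClique G R → R ⊆ W → ∃ λ c → c List.∈ list × R ⊆ c
      antichain : ∀ {c d} → c List.∈ list → d List.∈ list → c ⊆ d → c ≡ d

  private
    module AddSimplicial {W u} (u∈W : u ∈ W)
      (simplicial : ∀ {s t} → s ∈ W → t ∈ W → u ~ s → u ~ t → s ≢ t → s ~ t)
      (rest : RunningCliques (W - u)) where
      open RunningCliques rest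

      neighbour? : U.Decidable (λ z → z ∈ W × u ~ z)
      neighbour? z = (z ∈? W) ×-dec (u ~? z)

      N N⁺ : Subset n
      N  = comprehension neighbour?
      N⁺ = N ∪ ⁅ u ⁆

      W-u⊆W : W - u ⊆ W
      W-u⊆W = p─q⊆p W ⁅ u ⁆

      -- The strict inclusion of `W - u` in `W` comes with a missing element; it can only be `u`, as
      -- all others remain.
      u∉W-u : u ∉ W - u
      u∉W-u u∈ = proj₂ (proj₂ (proj₂ (x∈p⇒p-x⊂p u∈W)))
        (subst (_∈ W - u) (sym witness≡u) u∈)
        where
        witness = proj₁ (proj₂ (x∈p⇒p-x⊂p u∈W))
        witness≡u : witness ≡ u
        witness≡u = decidable-stable (witness ≟ u) λ ≢u →
          proj₂ (proj₂ (proj₂ (x∈p⇒p-x⊂p u∈W)))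
            (x∈p∧x≢y⇒x∈p-y (proj₁ (proj₂ (proj₂ (x∈p⇒p-x⊂p u∈W)))) ≢u)

      u∉ : ∀ {c} → c List.∈ list → u ∉ c
      u∉ c∈ = u∉W-u ∘ within c∈

      N⁺-split : ∀ {z} → z ∈ N⁺ → (z ∈ W × u ~ z) ⊎ z ≡ u
      N⁺-split z∈ = Sum.map (∈-comprehension⁻ neighbour?) (x∈⁅y⁆⇒x≡y u) (x∈p∪q⁻ N ⁅ u ⁆ z∈)

      N-clique : IsClique G N
      N-clique s t s∈ t∈ s≢t =
        let s∈W , u~s = ∈-comprehension⁻ neighbour? s∈
            t∈W , u~t = ∈-comprehension⁻ neighbour? t∈
        in simplicial s∈W t∈W u~s u~t s≢t

      N⊆W-u : N ⊆ W - u
      N⊆W-u z∈ = let z∈W , u~z = ∈-comprehension⁻ neighbour? z∈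
                 in x∈p∧x≢y⇒x∈p-y z∈W (λ { refl → ~-irrefl refl u~z })

      N⁺-clique : IsClique G N⁺
      N⁺-clique s t s∈ t∈ s≢t with N⁺-split s∈ | N⁺-split t∈
      ... | inj₁ (s∈W , u~s) | inj₁ (t∈W , u~t) = simplicial s∈W t∈W u~s u~t s≢t
      ... | inj₁ (_ , u~s)   | inj₂ refl        = ~-sym u~s
      ... | inj₂ refl        | inj₁ (_ , u~t)   = u~t
      ... | inj₂ refl        | inj₂ refl        = contradiction refl s≢t

      N⁺⊆W : N⁺ ⊆ W
      N⁺⊆W z∈ with N⁺-split z∈
      ... | inj₁ (z∈W , _) = z∈W
      ... | inj₂ refl      = u∈W

      u∈N⁺ : u ∈ N⁺
      u∈N⁺ = x∈p∪q⁺ (inj₂ (x∈⁅x⁆ u))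

      with-u : ∀ {R} → IsClique G R → R ⊆ W → u ∈ R → R ⊆ N⁺
      with-u clique R⊆W u∈R {z} z∈R with u ≟ z
      ... | yes refl = u∈N⁺
      ... | no u≢z   = p⊆p∪q ⁅ u ⁆
        (∈-comprehension⁺ neighbour? (R⊆W z∈R , clique u z u∈R z∈R u≢z))

      without-u : ∀ {R} → R ⊆ W → u ∉ R → R ⊆ W - u
      without-u R⊆W u∉R z∈R = x∈p∧x≢y⇒x∈p-y (R⊆W z∈R) (λ { refl → u∉R z∈R })

      ∈N⁺∧≢u⇒∈N : ∀ {z} → z ∈ N⁺ → z ≢ u → z ∈ N
      ∈N⁺∧≢u⇒∈N z∈ z≢u with x∈p∪q⁻ N ⁅ u ⁆ z∈
      ... | inj₁ z∈N = z∈N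
      ... | inj₂ z∈u = contradiction (x∈⁅y⁆⇒x≡y u z∈u) z≢u

      prepend : ∀ {c} → c List.∈ list → N ⊆ c → N ≢ c → RunningCliques W
      prepend {c} c∈ N⊆c N≢c = record
        { list      = N⁺ ∷ list
        ; running   = attach c∈
            (λ e∈ z∈N⁺ z∈e → N⊆c (∈N⁺∧≢u⇒∈N z∈N⁺ λ { refl → u∉ e∈ z∈e }))
            (λ N⁺∈ → u∉ N⁺∈ u∈N⁺) running
        ; clique    = λ { (here refl) → N⁺-clique ; (there d∈) → clique d∈ }
        ; within    = λ { (here refl) → N⁺⊆W ; (there d∈) → W-u⊆W ∘ within d∈ }
        ; covers    = cov
        ; antichain = anti
        }
        where
        cov : ∀ {R} → IsClique G R → R ⊆ W → ∃ λ c → c List.∈ N⁺ ∷ list × R ⊆ c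
        cov {R} cl R⊆W with u ∈? R
        ... | yes u∈R = N⁺ , here refl , with-u cl R⊆W u∈R
        ... | no u∉R  = let d , d∈ , R⊆d = covers cl (without-u R⊆W u∉R) in d , there d∈ , R⊆d
        anti : ∀ {d e} → d List.∈ N⁺ ∷ list → e List.∈ N⁺ ∷ list → d ⊆ e → d ≡ e
        anti (here refl) (here refl) _   = refl
        anti (here refl) (there e∈)  sub = contradiction (sub u∈N⁺) (u∉ e∈)
        anti (there d∈)  (there e∈)  sub = antichain d∈ e∈ sub
        -- An old `d` inside `N⁺` lies in `N`, hence in `c`; so `d` is `c`, and `N` would equal `c`.
        anti {d} (there d∈) (here refl) sub =
          let d⊆N : d ⊆ N
              d⊆N = λ z∈d → ∈N⁺∧≢u⇒∈N (sub z∈d) λ { refl → u∉ d∈ z∈d }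
              d≡c = antichain d∈ c∈ (N⊆c ∘ d⊆N)
          in contradiction (⊆-antisym N⊆c (subst (_⊆ N) d≡c d⊆N)) N≢c

      enlarge : Subset n → Subset n
      enlarge c with c ≟ˢ N
      ... | yes _ = N⁺
      ... | no _  = c

      enlarge-grows : ∀ c → c ⊆ enlarge c
      enlarge-grows c with c ≟ˢ N
      ... | yes refl = p⊆p∪q ⁅ u ⁆
      ... | no _     = id

      enlarge-N : enlarge N ≡ N⁺
      enlarge-N with N ≟ˢ N
      ... | yes _  = refl
      ... | no N≢N = contradiction refl N≢N

      enlarge-split : ∀ c {z} → z ∈ enlarge c → z ∈ c ⊎ (z ≡ u × c ≡ N)
      enlarge-split c {z} z∈ with c ≟ˢ N
      ... | no _ = inj₁ z∈
      ... | yes refl with z ≟ u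
      ...   | yes z≡u = inj₂ (z≡u , refl)
      ...   | no z≢u  = inj₁ (∈N⁺∧≢u⇒∈N z∈ z≢u)

      -- The only new vertex is `u`, and only the member equal to `N` receives it.
      enlarge-meet : ∀ {c d} → c List.∈ list → d List.∈ list → c ≢ d →
        ∀ {z} → z ∈ enlarge c → z ∈ enlarge d → z ∈ c × z ∈ d
      enlarge-meet {c} {d} c∈ d∈ c≢d zc zd with enlarge-split c zc | enlarge-split d zd
      ... | inj₁ zc′        | inj₁ zd′        = zc′ , zd′
      ... | inj₁ zc′        | inj₂ (refl , _) = contradiction zc′ (u∉ c∈)
      ... | inj₂ (refl , _) | inj₁ zd′        = contradiction zd′ (u∉ d∈)
      ... | inj₂ (_ , c≡N)  | inj₂ (_ , d≡N)  = contradiction (trans c≡N (sym d≡N)) c≢d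

      enlarge-antichain : ∀ {c d} → c List.∈ list → d List.∈ list → enlarge c ⊆ enlarge d → c ≡ d
      enlarge-antichain {c} {d} c∈ d∈ sub = decidable-stable (c ≟ˢ d) λ c≢d →
        c≢d (antichain c∈ d∈ λ z∈ → let z∈⁺ = enlarge-grows c z∈
          in proj₂ (enlarge-meet c∈ d∈ c≢d z∈⁺ (sub z∈⁺)))

      replace : N List.∈ list → RunningCliques W
      replace N∈ = record
        { list      = map enlarge list
        ; running   = running-map enlarge enlarge-grows enlarge-meet
            (λ c∈ d∈ eq → enlarge-antichain c∈ d∈ λ {x} → subst (x ∈_) eq) running
        ; clique    = λ c∈ → cl (∈-map⁻ enlarge c∈)
        ; within    = λ c∈ → wi (∈-map⁻ enlarge c∈)
        ; covers    = cov
        ; antichain = λ c∈ d∈ → anti (∈-map⁻ enlarge c∈) (∈-map⁻ enlarge d∈)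
        }
        where
        Image : Subset n → Set
        Image e = ∃ λ c → c List.∈ list × e ≡ enlarge c
        cl : ∀ {e} → Image e → IsClique G e
        cl (c , c∈ , refl) with c ≟ˢ N
        ... | yes _ = N⁺-clique
        ... | no _  = clique c∈
        wi : ∀ {e} → Image e → e ⊆ W
        wi (c , c∈ , refl) with c ≟ˢ N
        ... | yes _ = N⁺⊆W
        ... | no _  = W-u⊆W ∘ within c∈
        cov : ∀ {R} → IsClique G R → R ⊆ W → ∃ λ c → c List.∈ map enlarge list × R ⊆ c
        cov {R} cl R⊆W with u ∈? R
        ... | yes u∈R = enlarge N , ∈-map⁺ enlarge N∈ ,
          subst (R ⊆_) (sym enlarge-N) (with-u cl R⊆W u∈R)
        ... | no u∉R = let d , d∈ , R⊆d = covers cl (without-u R⊆W u∉R)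
          in enlarge d , ∈-map⁺ enlarge d∈ , enlarge-grows d ∘ R⊆d
        anti : ∀ {c d} → Image c → Image d → c ⊆ d → c ≡ d
        anti (c , c∈ , refl) (d , d∈ , refl) sub = cong enlarge (enlarge-antichain c∈ d∈ sub)

      -- The neighbourhood `N` is a clique, so some old `c` contains it. If `N` is `c`, then `c`
      -- ceases to be maximal and grows to `N⁺`; otherwise `N⁺` is a further maximal clique,
      -- attached to `c`.
      added : RunningCliques W
      added with covers N-clique N⊆W-u
      ... | c , c∈ , N⊆c with N ≟ˢ c
      ...   | yes refl = replace c∈
      ...   | no N≢c   = prepend c∈ N⊆c N≢c

  module _ (chordal : Chordal G) where

    private
      build : ∀ W → Acc _⊂_ W → RunningCliques W
      build W (acc rec)
        with any? (λ x → any? (λ y → (x ∈? W) ×-dec ((y ∈? W) ×-dec (¬? (x ≟ y) ×-dec ¬? (x ~? y)))))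
      ... | yes (x , y , x∈ , y∈ , x≢y , x≁y) =
        let u , u∈W , _ , _ , simplicial = dirac G chordal W (acc rec) x∈ y∈ x≢y x≁y
        in AddSimplicial.added u∈W simplicial (build (W - u) (rec (x∈p⇒p-x⊂p u∈W)))
      -- All of `W` is a clique; this includes the empty `W`, whose maximal clique is the empty set.
      ... | no ¬∃ = record
        { list      = W ∷ []
        ; running   = [ W ]
        ; clique    = λ { (here refl) x y x∈ y∈ x≢y →
                          decidable-stable (x ~? y) λ x≁y → ¬∃ (x , y , x∈ , y∈ , x≢y , x≁y) }
        ; within    = λ { (here refl) → id }
        ; covers    = λ _ R⊆W → W , here refl , R⊆W
        ; antichain = λ { (here refl) (here refl) _ → refl }
        }

    runningCliques : ∀ W → RunningCliques W
    runningCliques W = build W (⊂-wellFounded W)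

-- Junction trees from an order of the cliques

module _ {K n} {C : Fin K → Subset n} (root : Fin K) (rank : Fin K → ℕ)
  (rank-injective : ∀ {i j} → rank i ≡ rank j → i ≡ j)
  (attachment : ∀ i → i ≢ root → ∃ λ p → rank p ℕ.< rank i ×
     ∀ {j} → rank j ℕ.< rank i → ∀ {x} → x ∈ C i → x ∈ C j → x ∈ C p) where

  private
    parent : Fin K → Fin K
    parent i with i ≟ root
    ... | yes _  = i
    ... | no i≢r = proj₁ (attachment i i≢r)

    descends : ∀ {i} → i ≢ root → rank (parent i) ℕ.< rank i
    descends {i} i≢r with i ≟ root
    ... | yes i≡r  = contradiction i≡r i≢r
    ... | no i≢r   = proj₁ (proj₂ (attachment i i≢r))

    absorbs : ∀ {i j} → i ≢ root → rank j ℕ.< rank i → ∀ {x} → x ∈ C i → x ∈ C j → x ∈ C (parent i)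
    absorbs {i} i≢r j<i with i ≟ root
    ... | yes i≡r  = contradiction i≡r i≢r
    ... | no i≢r   = proj₂ (proj₂ (attachment i i≢r)) j<i

    tree : RootedTree K
    tree = record { root = root ; parent = parent ; rank = rank ; descends = descends }

    open RootedTree tree using (Below; here; up; below-rank; root-below; ¬below⇒≢root)

    -- If `j` comes before `i`, this is the attachment of `i`. If it comes after, the attachment of
    -- `j` passes `x` to the parent of `j`, which is still outside the subtree of `i`.
    running : ∀ {i j} → Acc ℕ._<_ (rank j) → ¬ Below i j →
      ∀ {x} → x ∈ C i → x ∈ C j → x ∈ C (parent i)
    running {i} {j} (acc rec) ¬b xi xj with ℕ.<-cmp (rank j) (rank i)
    ... | tri< j<i _ _ = absorbs (¬below⇒≢root ¬b) j<i xi xj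
    ... | tri≈ _ j≡i _ = contradiction (subst (Below i) (sym (rank-injective j≡i)) here) ¬b
    ... | tri> _ _ i<j with j ≟ root
    ...   | yes refl = contradiction (below-rank (root-below i)) (ℕ.<⇒≱ i<j)
    ...   | no j≢r   = running (rec (descends j≢r)) (¬b ∘ up j≢r) xi (absorbs j≢r i<j xj xi)

  fromOrder : JunctionTree C
  fromOrder = record { tree = tree ; running = running (<-wellFounded _) }

  fromOrder-parent : ∀ {i} (i≢r : i ≢ root) →
    rank (parent i) ℕ.< rank i × (∀ {j} → rank j ℕ.< rank i → ∀ {x} → x ∈ C i → x ∈ C j → x ∈ C (parent i))
  fromOrder-parent i≢r = descends i≢r , absorbs i≢r

module _ {n} {G : Graph n} (cliques : RunningCliques G ⊤) where
  open RunningCliques cliques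

  junctionTree : ∀ {K} {C : Fin K → Subset n} → CliqueCover G C → JunctionTree C
  -- The empty set is a clique and must be covered, so the family is not empty.
  junctionTree {zero} cover with proj₁ (CliqueCover.covered cover {⊥} λ u v u∈ → contradiction u∈ ∉⊥)
  ... | ()
  junctionTree {suc K} {C} cover =
    let root , last = argmax (toℕ ∘ pos)
    in fromOrder root rank rank-injective (attachment root last)
    where
    module Cover = CliqueCover cover
    -- The list and the family are both antichains of cliques covering all cliques, so they have the
    -- same members.
    C∈ : ∀ i → C i List.∈ list
    C∈ i =
      let c , c∈ , Ci⊆c = covers (Cover.clique i) (λ _ → ∈⊤)
          j , c⊆Cj = Cover.covered (clique c∈)
          i≡j = Cover.antichain (c⊆Cj ∘ Ci⊆c)
      in subst (List._∈ list) (⊆-antisym (subst (λ k → c ⊆ C k) (sym i≡j) c⊆Cj) Ci⊆c) c∈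
    pos : Fin (suc K) → Fin (length list)
    pos i = Any.index (C∈ i)
    lookup-pos : ∀ i → lookup list (pos i) ≡ C i
    lookup-pos i = sym (lookup-index (C∈ i))
    C-at : ∀ k → ∃ λ i → lookup list k ≡ C i
    C-at k =
      let i , k⊆i = Cover.covered (clique (∈-lookup k))
      in i , antichain (∈-lookup k) (C∈ i) k⊆i
    -- Members of the list attach to later ones, whereas ranks drop toward the root; hence positions
    -- are reversed.
    rank : Fin (suc K) → ℕ
    rank i = length list ∸ toℕ (pos i)
    rank⁻ : ∀ {i j} → rank j ℕ.< rank i → toℕ (pos i) ℕ.< toℕ (pos j)
    rank⁻ {i} {j} lt = ℕ.≰⇒> λ j≤i → ℕ.<⇒≱ lt (ℕ.∸-monoʳ-≤ (length list) j≤i)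
    pos-injective : ∀ {i j} → pos i ≡ pos j → i ≡ j
    pos-injective {i} {j} eq = Cover.antichain λ {x} → subst (x ∈_)
      (trans (sym (lookup-pos i)) (trans (cong (lookup list) eq) (lookup-pos j)))
    rank-injective : ∀ {i j} → rank i ≡ rank j → i ≡ j
    rank-injective {i} {j} eq = pos-injective (toℕ-injective
      (ℕ.∸-cancelˡ-≡ (ℕ.<⇒≤ (toℕ<n (pos i))) (ℕ.<⇒≤ (toℕ<n (pos j))) eq))
    attachment : ∀ root → (∀ j → toℕ (pos j) ℕ.≤ toℕ (pos root)) → ∀ i → i ≢ root →
      ∃ λ p → rank p ℕ.< rank i × ∀ {j} → rank j ℕ.< rank i → ∀ {x} → x ∈ C i → x ∈ C j → x ∈ C p
    attachment root last i i≢r with running-lookup running (pos i)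
    ... | inj₁ final = contradiction (pos-injective (toℕ-injective (ℕ.≤-antisym (last i)
      (ℕ.s≤s⁻¹ (subst (toℕ (pos root) ℕ.<_) (sym final) (toℕ<n (pos root))))))) i≢r
    ... | inj₂ (k , i<k , meets) =
      let p , k≡p = C-at k
          pos-p≡k = unique⇒lookup-injective (running-unique running) (trans (lookup-pos p) (sym k≡p))
      in p , ℕ.∸-monoʳ-< (subst (toℕ (pos i) ℕ.<_) (cong toℕ (sym pos-p≡k)) i<k)
               (ℕ.<⇒≤ (toℕ<n (pos p))) ,
         λ {j} j<i {x} xi xj → subst (x ∈_) k≡p (meets {pos j} (rank⁻ {i} {j} j<i)
           (subst (x ∈_) (sym (lookup-pos i)) xi) (subst (x ∈_) (sym (lookup-pos j)) xj))

-- Unions and counting over lists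

∈-⋃⁺ : ∀ {n x} {S : Subset n} {L} → S List.∈ L → x ∈ S → x ∈ ⋃ L
∈-⋃⁺ (here refl) x∈ = x∈p∪q⁺ (inj₁ x∈)
∈-⋃⁺ (there S∈)  x∈ = x∈p∪q⁺ (inj₂ (∈-⋃⁺ S∈ x∈))

∈-⋃⁻ : ∀ {n x} (L : List (Subset n)) → x ∈ ⋃ L → ∃ λ S → S List.∈ L × x ∈ S
∈-⋃⁻ []      x∈ = contradiction x∈ ∉⊥
∈-⋃⁻ (S ∷ L) x∈ with x∈p∪q⁻ S (⋃ L) x∈
... | inj₁ x∈S = S , here refl , x∈S
... | inj₂ x∈L = let R , R∈ , x∈R = ∈-⋃⁻ L x∈L in R , there R∈ , x∈R

module _ {K} {P : Pred (Fin K) 0ℓ} (P? : U.Decidable P) where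

  private
    all-equal : ∀ {A : Set} {xs : List A} → length xs ≡ 1 → ∀ {x y} → x List.∈ xs → y List.∈ xs → x ≡ y
    all-equal {xs = _ ∷ []} _ (here x≡) (here y≡) = trans x≡ (sym y≡)

    singleton : ∀ {A : Set} {x : A} {xs} → Unique xs → x List.∈ xs → (∀ {y} → y List.∈ xs → y ≡ x) →
      length xs ≡ 1
    singleton {xs = _ ∷ []}    _ _ _ = refl
    singleton {xs = _ ∷ _ ∷ _} ((y≢z ∷ _) ∷ _) _ equal =
      contradiction (trans (equal (here refl)) (sym (equal (there (here refl))))) y≢z

  count≡1⇒≡ : length (filter P? (allFin K)) ≡ 1 → ∀ {k l} → P k → P l → k ≡ l
  count≡1⇒≡ eq pk pl = all-equal eq (∈-filter⁺ P? (∈-allFin _) pk) (∈-filter⁺ P? (∈-allFin _) pl)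

  unique⇒count≡1 : ∀ {k} → P k → (∀ {l} → P l → l ≡ k) → length (filter P? (allFin K)) ≡ 1
  unique⇒count≡1 pk equal = singleton (Unique.filter⁺ P? (Unique.allFin⁺ K))
    (∈-filter⁺ P? (∈-allFin _) pk) (λ l∈ → equal (proj₂ (∈-filter⁻ P? {xs = allFin K} l∈)))

first : ∀ {K} → Fin K → ∃ λ (z : Fin K) → toℕ z ≡ 0
first {suc K} _ = zero , refl

-- Perfect sequences

module PerfectSequence {K n} (C : Fin K → Subset n) (π : Permutation′ K) where

  -- `sep` and `multiplicity`, built on this set, unfold at the family `C G` to `separatorAt` and
  -- `ν`.
  earlier : Fin K → Subset n
  earlier k = ⋃ (map (λ j → C (π ⟨$⟩ʳ j)) (filter (_<? k) (allFin K)))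

  sep : Fin K → Subset n
  sep k = earlier k ∩ C (π ⟨$⟩ʳ k)

  multiplicity : Subset n → ℕ
  multiplicity S = length (filter (λ k → (0 ℕ.<? toℕ k) ×-dec (sep k ≟ˢ S)) (allFin K))

  ∈-earlier⁺ : ∀ {j k x} → j < k → x ∈ C (π ⟨$⟩ʳ j) → x ∈ earlier k
  ∈-earlier⁺ {j} {k} j<k = ∈-⋃⁺ (∈-map⁺ (λ j → C (π ⟨$⟩ʳ j)) (∈-filter⁺ (_<? k) (∈-allFin j) j<k))

  ∈-earlier⁻ : ∀ {k x} → x ∈ earlier k → ∃ λ j → j < k × x ∈ C (π ⟨$⟩ʳ j)
  ∈-earlier⁻ {k} x∈ with ∈-⋃⁻ _ x∈
  ... | S , S∈ , x∈S with ∈-map⁻ (λ j → C (π ⟨$⟩ʳ j)) S∈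
  ...   | j , j∈ , refl = j , proj₂ (∈-filter⁻ (_<? k) {xs = allFin K} j∈) , x∈S

  module _ (perfect : ∀ k → 0 ℕ.< toℕ k → ∃ λ k′ → k′ < k × sep k ⊆ C (π ⟨$⟩ʳ k′))
    (z : Fin K) (z≡0 : toℕ z ≡ 0) where

    private
      root : Fin K
      root = π ⟨$⟩ʳ z

      at : Fin K → Fin K
      at i = π ⟨$⟩ˡ i

      rank : Fin K → ℕ
      rank i = toℕ (at i)

      C-at : ∀ {i x} → x ∈ C i → x ∈ C (π ⟨$⟩ʳ at i)
      C-at {x = x} = subst (λ k → x ∈ C k) (sym (inverseʳ π))

      at-injective : ∀ {i j} → at i ≡ at j → i ≡ j
      at-injective eq = trans (sym (inverseʳ π)) (trans (cong (π ⟨$⟩ʳ_) eq) (inverseʳ π))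

      positive : ∀ {i} → i ≢ root → 0 ℕ.< rank i
      positive {i} i≢r = ℕ.n≢0⇒n>0 λ rank≡0 → i≢r
        (trans (sym (inverseʳ π)) (cong (π ⟨$⟩ʳ_) (toℕ-injective (trans rank≡0 (sym z≡0)))))

      positive⁻ : ∀ {k} → 0 ℕ.< toℕ k → π ⟨$⟩ʳ k ≢ root
      positive⁻ {k} 0<k eq = ℕ.<⇒≢ 0<k (sym (trans (cong toℕ
        (trans (sym (inverseˡ π)) (trans (cong at eq) (inverseˡ π)))) z≡0))

      attachment : ∀ i → i ≢ root → ∃ λ p → rank p ℕ.< rank i ×
        ∀ {j} → rank j ℕ.< rank i → ∀ {x} → x ∈ C i → x ∈ C j → x ∈ C p
      attachment i i≢r with perfect (at i) (positive i≢r)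
      ... | k , k<i , sub = π ⟨$⟩ʳ k , subst (λ l → toℕ l ℕ.< rank i) (sym (inverseˡ π)) k<i ,
        λ j<i xi xj → sub (x∈p∩q⁺ (∈-earlier⁺ j<i (C-at xj) , C-at xi))

    perfectTree : JunctionTree C
    perfectTree = fromOrder root rank (at-injective ∘ toℕ-injective) attachment

    open JunctionTree perfectTree using (parent; separator)

    private
      -- The parent is one of the earlier cliques, and it absorbs what `C i` shares with any of
      -- them.
      separator≡sep : ∀ {i} → i ≢ root → separator i ≡ sep (at i)
      separator≡sep {i} i≢r = ⊆-antisym
        (λ x∈ → let xi , xp = x∈p∩q⁻ (C i) _ x∈ in
          x∈p∩q⁺ (∈-earlier⁺ parent< (C-at xp) , C-at xi))
        (λ {x} x∈ → let x∈⋃ , x∈C = x∈p∩q⁻ (earlier (at i)) _ x∈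
                        j , j<i , xj = ∈-earlier⁻ x∈⋃
                        xi = subst (λ k → x ∈ C k) (inverseʳ π) x∈C
          in x∈p∩q⁺ (xi , absorbs (subst (λ l → toℕ l ℕ.< rank i) (sym (inverseˡ π)) j<i) xi xj))
        where
        parent< = proj₁ (fromOrder-parent {C = C} root rank (at-injective ∘ toℕ-injective) attachment i≢r)
        absorbs : ∀ {j} → rank j ℕ.< rank i → ∀ {x} → x ∈ C i → x ∈ C j → x ∈ C (parent i)
        absorbs = proj₂ (fromOrder-parent {C = C} root rank (at-injective ∘ toℕ-injective) attachment i≢r)

    -- Positive positions correspond to the edges of `perfectTree`, with the same separators. So
    -- `multiplicity S` counts the edges with separator `S`, and for a minimal separator there is at
    -- least one.
    multiplicity-one⇔injective : ∀ {G : Graph n} (cover : CliqueCover G C) →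
      InjectiveSeparators cover perfectTree ⇔ (∀ S → IsMinimalSeparator G S → multiplicity S ≡ 1)
    multiplicity-one⇔injective {G} cover = mk⇔ to from
      where
      occurs? : ∀ S → U.Decidable (λ k → 0 ℕ.< toℕ k × sep k ≡ S)
      occurs? S k = (0 ℕ.<? toℕ k) ×-dec (sep k ≟ˢ S)
      to : InjectiveSeparators cover perfectTree → ∀ S → IsMinimalSeparator G S → multiplicity S ≡ 1
      to inj S min with minimal-separator cover perfectTree min
      ... | e , e≢r , refl = unique⇒count≡1 (occurs? S)
        (positive e≢r , sym (separator≡sep e≢r))
        λ {l} (0<l , sep≡) → trans (sym (inverseˡ π)) (cong at (inj (positive⁻ 0<l) e≢r
          (trans (separator≡sep (positive⁻ 0<l)) (trans (cong sep (inverseˡ π)) sep≡))))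
      from : (∀ S → IsMinimalSeparator G S → multiplicity S ≡ 1) → InjectiveSeparators cover perfectTree
      from once {k} {l} k≢r l≢r eq = at-injective (count≡1⇒≡ (occurs? (separator k))
        (once (separator k) (separator-minimal cover perfectTree k≢r))
        (positive k≢r , sym (separator≡sep k≢r))
        (positive l≢r , trans (sym (separator≡sep l≢r)) (sym eq)))

-- Uniqueness of the clique tree

module _ {K n} {G : Graph n} {C : Fin K → Subset n} (cover : CliqueCover G C) where

  IsJunctionTree : Graph K → Set
  IsJunctionTree T = IsTree T ×
    (∀ {i j} (p : Walk T i j) → IsPath T p →
     ∀ {k} → k List.∈ vertices T p → C i ∩ C j ⊆ C k)

  isJunctionTree : (J : JunctionTree C) → IsJunctionTree (JunctionTree.asGraph J)
  isJunctionTree J = JunctionTree.isTree J , JunctionTree.junction J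

  private
    rerooted : ∀ {T} → IsJunctionTree T → Fin K → JunctionTree C
    rerooted {T} (tree , junction) z = junctionRootedAt T tree z C junction

    -- With `z` as root, `y` is the parent of `x` and `z` that of `y`, the position required by
    -- `Reattach`. Uniqueness puts the new edge x - z into `T`, which would make `z` the parent of
    -- `x`.
    no-shortcut : ∀ {T} (jt : IsJunctionTree T) → (∀ {T′} → IsJunctionTree T′ → T ≋ T′) →
      ∀ {x y z} → Graph._~_ T x y → Graph._~_ T y z → x ≢ z → ¬ C x ∩ C y ⊆ C z
    no-shortcut {T} jt@(tree , junction) only {x} {y} {z} x~y y~z x≢z sub
      with edge-complete T tree z x~y | edge-complete T tree z y~z
    ... | _ | inj₂ (z≢z , _) = z≢z refl
    ... | inj₂ (_ , x≡py) | inj₁ (_ , z≡py) = x≢z (trans x≡py (sym z≡py))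
    ... | inj₁ (_ , y≡px) | inj₁ (y≢z , z≡py)
      with edge-complete T tree z (Equivalence.from (only (isJunctionTree reattached) x z) reattached-edge)
      where open Reattach (rerooted jt z) x≢z y≢z (sym y≡px) (sym z≡py) sub
    ...   | inj₁ (_ , z≡px) = y≢z (trans y≡px (sym z≡px))
    ...   | inj₂ (z≢z , _)  = z≢z refl

    unique⇒not-nested : ∀ {T} (jt : IsJunctionTree T) → (∀ {T′} → IsJunctionTree T′ → T ≋ T′) →
      (z : Fin K) → let open JunctionTree (rerooted jt z) in
      ∀ {k l} → k ≢ root → l ≢ root → k ≢ l → ¬ separator k ⊆ separator l
    unique⇒not-nested {T} jt@(tree , _) only z k≢r l≢r k≢l nested =
      let x , y , w , xy , yw , x≢w , sub =
            nested⇒adjacent (rerooted jt z) k≢r l≢r k≢l nested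
      in no-shortcut jt only (edge-sound T tree z xy) (edge-sound T tree z yw) x≢w sub

    edges⊆ : (J J′ : JunctionTree C) → InjectiveSeparators cover J′ → NoInclusions G →
      ∀ {i j} → JunctionTree.Edge J i j → JunctionTree.Edge J′ i j
    edges⊆ J J′ inj none = λ
      { (inj₁ (i≢r , refl)) → forced i≢r
      ; (inj₂ (j≢r , refl)) → Sum.swap (forced j≢r) }
      where
      open JunctionTree J
      module J′ = JunctionTree J′
      forced : ∀ {i} → i ≢ root → J′.Edge i (parent i)
      forced {i} i≢r = forced-edge J′ (parent-≢ i≢r) (p∩q⊆p _ _) (p∩q⊆q (C i) _)
        (λ e≢r sub → ⊆∧⊄⇒≡ sub
          (none _ _ (separator-minimal cover J i≢r) (separator-minimal cover J′ e≢r)))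
        inj

  module _ (E : Enumeration (IsMinimalSeparator G)) (J : JunctionTree C) where
    open JunctionTree J using (root; asGraph)

    unique⇒ : ∃! _≋_ IsJunctionTree → (size E ≡ K ∸ 1) × NoInclusions G
    unique⇒ (T , jt , only) = Equivalence.from (size≡⇔injective cover J′ E) injective , none
      where
      J′ = rerooted jt root
      not-nested = unique⇒not-nested jt only root
      -- Equal separators are nested, so `not-nested` yields both conditions.
      injective : InjectiveSeparators cover J′
      injective {k} {l} k≢r l≢r eq = decidable-stable (k ≟ l) λ k≢l →
        not-nested k≢r l≢r k≢l (λ {x} → subst (x ∈_) eq)
      none : NoInclusions G
      none S S′ min min′ S⊂S′
        with minimal-separator cover J′ min | minimal-separator cover J′ min′
      ... | k , k≢r , refl | l , l≢r , refl = not-nested k≢r l≢r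
        (λ { refl → let _ , x , x∈ , x∉ = S⊂S′ in x∉ x∈ }) (p⊂q⇒p⊆q S⊂S′)

    unique⇐ : (size E ≡ K ∸ 1) × NoInclusions G → ∃! _≋_ IsJunctionTree
    unique⇐ (size≡ , none) = asGraph , isJunctionTree J , same
      where
      -- The count does not mention a tree, so it gives injectivity in every junction tree, as the
      -- two inclusions of edge sets require.
      injective : (J : JunctionTree C) → InjectiveSeparators cover J
      injective J = Equivalence.to (size≡⇔injective cover J E) size≡
      same : ∀ {T} → IsJunctionTree T → asGraph ≋ T
      same {T} jt@(tree , _) i j = mk⇔
        (edge-sound T tree root ∘ edges⊆ J J′ (injective J′) none)
        (edges⊆ J′ J (injective J) none ∘ edge-complete T tree root)
        where J′ = rerooted jt root

    unique⇔ : ∃! _≋_ IsJunctionTree ⇔ ((size E ≡ K ∸ 1) × NoInclusions G)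
    unique⇔ = mk⇔ unique⇒ unique⇐

    size≡⇔multiplicity-one : let open PerfectSequence C in (π : Permutation′ K) →
      (∀ k → 0 ℕ.< toℕ k → IsClique G (sep π k) × ∃ λ k′ → k′ < k × sep π k ⊆ C (π ⟨$⟩ʳ k′)) →
      (size E ≡ K ∸ 1) ⇔ (∀ S → IsMinimalSeparator G S → multiplicity π S ≡ 1)
    size≡⇔multiplicity-one π perfect =
      let z , z≡0 = first root
          perfect′ = λ k 0<k → proj₂ (perfect k 0<k)
      in multiplicity-one⇔injective π perfect′ z z≡0 cover
         ⇔-∘ size≡⇔injective cover (perfectTree π perfect′ z z≡0) E
      where open PerfectSequence C

theorem5p2 : (n : ℕ) (G : Graph n) → Connected G → Chordal G →
    (UniqueCliqueTree G ⇔ ((∣𝒮∣ G ≡ ∣𝒞∣ G ∸ 1) × NoInclusions G))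
    × ((π : Permutation′ (∣𝒞∣ G)) → IsPerfect G π →
    ((∣𝒮∣ G ≡ ∣𝒞∣ G ∸ 1) ⇔ (∀ S → IsMinimalSeparator G S → ν G π S ≡ 1)))
theorem5p2 n G _ chordal =
  unique⇔ cover (minimalSeparators G) tree ,
  size≡⇔multiplicity-one cover (minimalSeparators G) tree
  where
  cover = maximalCliqueCover G
  tree  = junctionTree (runningCliques G chordal ⊤) cover
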